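{- Let $n$ be a positive integer, let $v=4n+2$, and let $X$ be a $v$-set partitioned into two subsets $\{a_0,a_1,\dots,a_{2n}\}$ and $\{b_0,b_1,\dots,b_{2n}\}$ (each of size $2n+1$). (i) Suppose $2n+1\equiv 1,3\pmod 6$. Let $\mathrm{STS}(2n+1)$ be a Steiner triple system on the point set $\{a_0,\dots,a_{2n}\}$, where the block $a_{\beta_0}a_{\beta_1}a_{\beta_2}$ is written via its indices as $\beta_0\beta_1\beta_2$. Then $$h_1=\sum_{\beta_0\beta_1\beta_2\in \mathrm{STS}(2n+1)} T(a_{\beta_0}b_{\beta_0},\,a_{\beta_1}b_{\beta_1},\,a_{\beta_2}b_{\beta_2},\,a_{\beta_0}b_{\beta_0})$$ is a $\mathrm{T}(2,3,4n+2)$ trade with volume $2\binom{2n+1}{2}$. (ii) Suppose $2n+1\equiv 5\pmod 6$. Let $\mathrm{STS}(2n-1)$ be a Steiner triple system on the point set $\{a_0,\dots,a_{2n-2}\}$, with blocks again written via their indices, and let $S$ be a partition of $\{a_0,\dots,a_{2n-3}\}$ into $2$-subsets. Then $$\begin{aligned} h_2=&\sum_{\beta_0\beta_1\beta_2\in \mathrm{STS}(2n-1)} T(a_{\beta_0}b_{\beta_0},\,a_{\beta_1}b_{\beta_1},\,a_{\beta_2}b_{\beta_2},\,a_{\beta_0}b_{\beta_0})\\ &+T(a_{2n-2}b_{2n-2},\,a_{2n-1}b_{2n-1},\,a_{2n}b_{2n},\,a_{2n-2}b_{2n-2})\\ &+\sum_{a_ia_j\in S} T(a_{2n-1}b_{2n-1},\,a_ib_i,\,a_{2n}b_{2n},\,a_jb_j,\,a_{2n-1}b_{2n-1})\end{aligned}$$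 is a $\mathrm{T}(2,3,4n+2)$ trade with volume $2\binom{2n+1}{2}$. (In both parts, the order in which the elements of each block of the Steiner triple system, or of each pair of $S$, are listed is arbitrary but fixed.)
   Context: Let $X$ be a $v$-set and let $\binom{X}{i}$ denote the set of $i$-subsets of $X$. Elements of $\binom{X}{k}$ are called blocks. A set $\{x_0,\dots,x_i\}$ is written as the string $x_0\cdots x_i$. A function $f:\binom{X}{k}\to\mathbb{Z}$ is identified with the formal $\mathbb{Z}$-linear combination of blocks $\sum_{B} f(B)\,B$. Trades. For integers $0\le t\le k\le v-t$, a $\mathrm{T}(t,k,v)$ trade is a function $f:\binom{X}{k}\to\mathbb{Z}$ such that for every $A\in\binom{X}{t}$, $\sum_{B\in\binom{X}{k},\,A\subseteq B} f(B)=0$. Write $f=f_0-f_1$ with $f_0=\max(f,0)$ and $f_1=\max(-f,0)$ (the two legs). The volume of the trade is $\sum_B f_0(B)=\sum_B f_1(B)$ (the number of blocks, counted with multiplicity, in each leg). Steiner triple systems. An $\mathrm{STS}(m)$ on an $m$-set $Y$ is a set of $3$-subsets (blocks) of $Y$ such that every $2$-subset of $Y$ is contained in exactly one block. It exists if and only if $m\equiv 1,3\pmod 6$. The trades $T(\mathcal{C})$. Products of distinct points denote the block consisting of these points, and products with sums are expanded multilinearly. Given a cycle $\mathcal{C}=(a_{i_0}b_{i_0},a_{i_1}b_{i_1},\dots,a_{i_m}b_{i_m})$ with $i_m=i_0$ in the complete graph whose vertices are the pairs $a_0b_0,\dots,a_{2n}b_{2n}$, define $$T(\mathcal{C})=T(a_{i_0}b_{i_0},\dots,a_{i_m}b_{i_m}):=\sum_{(a_ib_i,\,a_jb_j)\in\mathcal{C}}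 \Big(a_ib_i(a_j+b_j)-a_jb_j(a_i+b_i)\Big),$$ where the sum is over the edges of $\mathcal{C}$ directed in the order in which $\mathcal{C}$ traverses them, i.e. over the consecutive pairs $(i,j)=(i_s,i_{s+1})$, $0\le s<m$. -}

module Defs where

open import Data.Bool.Base using (if_then_else_)
import Data.Bool.Properties as Bool
open import Data.Fin.Base using (Fin; toℕ; fromℕ<)
open import Data.Fin.Subset
  using (Subset; inside; outside; _∈_; _⊆_; ⁅_⁆; _∩_; _∪_; ⋃; ∣_∣; Empty)
open import Data.Fin.Subset.Properties using (_⊆?_)
open import Data.Integer.Base using (ℤ; +_; 0ℤ; 1ℤ; _+_; _-_; -_; _⊔_)
open import Data.List.Base using (List; []; _∷_; _++_; map; filter; foldr; allFin)
import Data.List.Membership.Propositional as List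
open import Data.List.Relation.Unary.All using (All)
open import Data.List.Relation.Unary.AllPairs using (AllPairs)
open import Data.List.Relation.Unary.Unique.Propositional using (Unique)
open import Data.Nat.Base as ℕ using (ℕ; zero; suc; _≤_; _∸_; _*_; s≤s)
import Data.Nat.Properties as ℕ
open import Data.Product.Base using (Σ-syntax; ∃; _×_; _,_; proj₁)
open import Data.Product using (∃!)
open import Data.Sum.Base using (_⊎_)
open import Data.Vec.Base as Vec using (Vec)
import Data.Vec.Properties as Vec
open import Function.Base using (_∘_)
open import Function.Definitions using (Injective)
open import Relation.Binary.PropositionalEquality using (_≡_; _≢_; refl; cong)
open import Relation.Nullary using (Dec; does)

-- The v-set X is Fin v.
KSubset : ℕ → ℕ → Set
KSubset v k = Σ[ B ∈ Subset v ] ∣ B ∣ ≡ k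

-- Every k-subset, listed exactly once.
kSubsets : ∀ v k → List (KSubset v k)
kSubsets zero    zero    = (Vec.[] , refl) ∷ []
kSubsets zero    (suc k) = []
kSubsets (suc v) zero    =
  map (λ (B , eq) → outside Vec.∷ B , eq) (kSubsets v zero)
kSubsets (suc v) (suc k) =
  map (λ (B , eq) → inside Vec.∷ B , cong suc eq) (kSubsets v k) ++
  map (λ (B , eq) → outside Vec.∷ B , eq) (kSubsets v (suc k))

sumOver : {A : Set} → List A → (A → ℤ) → ℤ
sumOver xs f = foldr _+_ 0ℤ (map f xs)

FormalSum : ℕ → ℕ → Set
FormalSum v k = KSubset v k → ℤ

record IsTrade (t k v : ℕ) (f : FormalSum v k) : Set where
  field
    t≤k      : t ≤ k
    k≤v∸t    : k ≤ v ∸ t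
    balanced : ∀ (A : KSubset v t) →
      sumOver (filter (λ B → proj₁ A ⊆? proj₁ B) (kSubsets v k)) f ≡ 0ℤ

leg₀ leg₁ : ∀ {v k} → FormalSum v k → FormalSum v k
leg₀ f B = f B ⊔ 0ℤ
leg₁ f B = (- f B) ⊔ 0ℤ

HasVolume : ∀ {v k} → FormalSum v k → ℕ → Set
HasVolume {v} {k} f w =
  sumOver (kSubsets v k) (leg₀ f) ≡ + w ×
  sumOver (kSubsets v k) (leg₁ f) ≡ + w

-- A finite set of subsets is a duplicate-free list.
record IsSTS {v} (m : ℕ) (Y : Subset v) (𝓑 : List (Subset v)) : Set where
  field
    order  : ∣ Y ∣ ≡ m
    unique : Unique 𝓑
    blocks : All (λ B → ∣ B ∣ ≡ 3 × B ⊆ Y) 𝓑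
    steiner : ∀ (P : KSubset v 2) → proj₁ P ⊆ Y →
      ∃! _≡_ λ B → B List.∈ 𝓑 × proj₁ P ⊆ B

-- Disjointness of the members, none of which is empty, rules out duplicates.
record IsPairPartition {v} (Y : Subset v) (𝓢 : List (Subset v)) : Set where
  field
    pairs    : All (λ P → ∣ P ∣ ≡ 2) 𝓢
    disjoint : AllPairs (λ P Q → Empty (P ∩ Q)) 𝓢
    covers   : ⋃ 𝓢 ≡ Y

record IsLabelling {v l} (a b : Fin l → Fin v) : Set where
  field
    a-injective : Injective _≡_ _≡_ a
    b-injective : Injective _≡_ _≡_ b
    disjoint    : ∀ i j → a i ≢ b j
    covers      : ∀ x → (∃ λ i → a i ≡ x) ⊎ (∃ λ i → b i ≡ x)

-- firstPoints a m is {a₀, …, aₘ₋₁}.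
firstPoints : ∀ {v l} → (Fin l → Fin v) → ℕ → Subset v
firstPoints {l = l} a m =
  ⋃ (map (⁅_⁆ ∘ a) (filter (λ i → toℕ i ℕ.<? m) (allFin l)))

-- The index m − k among 0, …, m.
fromTop : (m k : ℕ) → Fin (suc m)
fromTop m k = fromℕ< {m ∸ k} (s≤s (ℕ.m∸n≤m m k))

-- An ordered triple (or pair) of indices is a set together with a choice of
-- the order in which its elements are listed.
Triple Pair : ℕ → Set
Triple l = Fin l × Fin l × Fin l
Pair   l = Fin l × Fin l

tripleSet : ∀ {v l} → (Fin l → Fin v) → Triple l → Subset v
tripleSet a (i , j , k) = ⁅ a i ⁆ ∪ ⁅ a j ⁆ ∪ ⁅ a k ⁆

pairSet : ∀ {v l} → (Fin l → Fin v) → Pair l → Subset v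
pairSet a (i , j) = ⁅ a i ⁆ ∪ ⁅ a j ⁆

_≟ˢ_ : ∀ {v} (p q : Subset v) → Dec (p ≡ q)
_≟ˢ_ = Vec.≡-dec Bool._≟_

-- The block xyz as a formal sum, for distinct x, y, z.
block : ∀ {v} → Fin v → Fin v → Fin v → FormalSum v 3
block x y z (B , _) =
  if does (B ≟ˢ (⁅ x ⁆ ∪ ⁅ y ⁆ ∪ ⁅ z ⁆)) then 1ℤ else 0ℤ

module _ {v l : ℕ} (a b : Fin l → Fin v) where

  edge : Fin l → Fin l → FormalSum v 3
  edge i j B =
    (block (a i) (b i) (a j) B + block (a i) (b i) (b j) B) -
    (block (a j) (b j) (a i) B + block (a j) (b j) (b i) B)

  -- A cycle is given by the indices i₀, i₁, …, iₘ of its vertices, with the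
  -- first one repeated at the end.
  T : List (Fin l) → FormalSum v 3
  T []           B = 0ℤ
  T (i ∷ [])     B = 0ℤ
  T (i ∷ j ∷ is) B = edge i j B + T (j ∷ is) B

  h₁ : List (Triple l) → FormalSum v 3
  h₁ sts B = sumOver sts λ (β₀ , β₁ , β₂) → T (β₀ ∷ β₁ ∷ β₂ ∷ β₀ ∷ []) B

h₂ : ∀ {v} n → (a b : Fin (suc (2 * n)) → Fin v) →
     List (Triple (suc (2 * n))) → List (Pair (suc (2 * n))) → FormalSum v 3
h₂ n a b sts S B =
  sumOver sts (λ (β₀ , β₁ , β₂) → T a b (β₀ ∷ β₁ ∷ β₂ ∷ β₀ ∷ []) B) +
  T a b (2n-2 ∷ 2n-1 ∷ 2n ∷ 2n-2 ∷ []) B +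
  sumOver S (λ (i , j) → T a b (2n-1 ∷ i ∷ 2n ∷ j ∷ 2n-1 ∷ []) B)
  where
  2n-2 2n-1 2n : Fin (suc (2 * n))
  2n-2 = fromTop (2 * n) 2
  2n-1 = fromTop (2 * n) 1
  2n   = fromTop (2 * n) 0

{-# OPTIONS --safe #-}

-- A cycle is read as a list of arcs (i , j), so that h₁ and h₂ are sums of
-- edge i j over one list E of arcs.  Balance: for a pair A, the blocks of an
-- arc (i , j) that contain A contribute φ i − φ j, where φ i is 2 if
-- A = aᵢbᵢ and 0 otherwise, and such differences telescope along a cycle.
-- Volume: a block containing aᵢbᵢ and a point with index j has positive sign
-- only through the arc (i , j) and negative sign only through (j , i).  If E is
-- a tournament (each pair of indices is joined by exactly one arc), there is
-- no cancellation, and each leg has two blocks for each of the C(l,2) arcs.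
-- For h₁ the tournament property is the Steiner property.  For h₂ the
-- quadrangles join the last two indices u and w to all indices below 2n−2, and
-- the remaining pairs at u and w lie in the triangle on 2n−2, u and w.

module Submission where

open import Defs
import Algebra.Properties.AbelianGroup as AbelianGroup
open import Data.Bool.Base using (Bool; true; false; if_then_else_)
open import Data.Empty using (⊥)
open import Data.Fin.Base using (Fin; zero; suc; toℕ)
open import Data.Fin.Properties using (_≟_; toℕ-injective; toℕ<n; toℕ-fromℕ<)
open import Data.Fin.Subset
  using (Subset; inside; outside; _∈_; _∉_; _⊆_; ⁅_⁆; _∩_; _∪_; ⋃; ∣_∣; Empty)
open import Data.Fin.Subset.Properties
open import Data.Integer.Base using (ℤ; +_; 0ℤ; 1ℤ; +≤+)
import Data.Integer.Properties as ℤ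
open import Data.Integer.Tactic.RingSolver using (solve-∀)
open import Data.List.Base
  using (List; []; _∷_; _++_; map; filter; foldr; concatMap; length; allFin)
import Data.List.Membership.Propositional as List
open import Data.List.Membership.Propositional.Properties
  using (∈-allFin; ∈-map⁺; ∈-map⁻; ∈-++⁺ˡ; ∈-++⁺ʳ; ∈-filter⁺; ∈-filter⁻)
open import Data.List.Properties using (map-∘; map-++; length-tabulate)
open import Data.List.Relation.Unary.All as All using (All; []; _∷_)
open import Data.List.Relation.Unary.AllPairs using (AllPairs; []; _∷_)
open import Data.List.Relation.Unary.Any using (here; there)
open import Data.List.Relation.Unary.Unique.Propositional using (Unique)
import Data.List.Relation.Unary.Unique.Propositional.Properties as Unique
open import Data.Nat.Base as ℕ using (ℕ; zero; suc; s≤s; z≤n; _∸_; _<_)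
open import Data.Nat.Combinatorics using (_C_; nC1≡n; nCk+nC[k+1]≡[n+1]C[k+1])
import Data.Nat.Properties as ℕ
import Data.Nat.Tactic.RingSolver as ℕ-Solver
open import Data.Product.Base using (∃; _×_; _,_; proj₁; proj₂)
open import Data.Sum.Base as Sum using (_⊎_; inj₁; inj₂; [_,_]′)
import Data.Vec.Base as Vec
import Data.Vec.Properties as Vec
open import Function.Base using (_∘_; id)
open import Function.Definitions using (Injective)
open import Relation.Binary.Definitions using (DecidableEquality)
open import Relation.Binary.PropositionalEquality
open import Relation.Nullary using (Dec; yes; no; does; ¬_; contradiction)
open import Relation.Nullary.Decidable using (dec-true; dec-false)
open import Relation.Unary using (Decidable)

-- Finite integer sums and indicators.

module Sums where
  open import Data.Integer.Base using (_+_; _-_; -_; _*_; _≤_)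

  -- Written with `does` exactly as in `block`, so that the coefficient of a block is an indicator
  -- by computation.
  𝟙 : {P : Set} → Dec P → ℤ
  𝟙 P? = if does P? then 1ℤ else 0ℤ

  𝟙-yes : {P : Set} (P? : Dec P) → P → 𝟙 P? ≡ 1ℤ
  𝟙-yes P? p rewrite dec-true P? p = refl

  𝟙-no : {P : Set} (P? : Dec P) → ¬ P → 𝟙 P? ≡ 0ℤ
  𝟙-no P? ¬p rewrite dec-false P? ¬p = refl

  𝟙-cong : {P Q : Set} (P? : Dec P) (Q? : Dec Q) → (P → Q) → (Q → P) → 𝟙 P? ≡ 𝟙 Q?
  𝟙-cong (yes p) Q? to from = sym (𝟙-yes Q? (to p))
  𝟙-cong (no ¬p) Q? to from = sym (𝟙-no Q? (¬p ∘ from))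

  𝟙-nonneg : {P : Set} (P? : Dec P) → 0ℤ ≤ 𝟙 P?
  𝟙-nonneg (yes _) = +≤+ z≤n
  𝟙-nonneg (no _)  = +≤+ z≤n

  module _ {A : Set} where

    sum-cong-∈ : ∀ (xs : List A) {f g : A → ℤ} →
      (∀ {x} → x List.∈ xs → f x ≡ g x) → sumOver xs f ≡ sumOver xs g
    sum-cong-∈ []       f≡g = refl
    sum-cong-∈ (x ∷ xs) f≡g = cong₂ _+_ (f≡g (here refl)) (sum-cong-∈ xs (f≡g ∘ there))

    sum-cong : ∀ (xs : List A) {f g : A → ℤ} →
      (∀ x → f x ≡ g x) → sumOver xs f ≡ sumOver xs g
    sum-cong xs f≡g = sum-cong-∈ xs λ {x} _ → f≡g x

    sum-0 : (xs : List A) → sumOver xs (λ _ → 0ℤ) ≡ 0ℤ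
    sum-0 []       = refl
    sum-0 (x ∷ xs) = trans (ℤ.+-identityˡ _) (sum-0 xs)

    sum-+ : ∀ (xs : List A) (f g : A → ℤ) →
      sumOver xs (λ x → f x + g x) ≡ sumOver xs f + sumOver xs g
    sum-+ []       f g = refl
    sum-+ (x ∷ xs) f g = trans (cong (λ s → f x + g x + s) (sum-+ xs f g)) (rearrange (f x) (g x) _ _)
      where
      rearrange : ∀ a b c d → a + b + (c + d) ≡ a + c + (b + d)
      rearrange = solve-∀

    sum-neg : ∀ (xs : List A) (f : A → ℤ) → sumOver xs (λ x → - f x) ≡ - sumOver xs f
    sum-neg []       f = refl
    sum-neg (x ∷ xs) f = trans (cong (λ s → - f x + s) (sum-neg xs f)) (sym (ℤ.neg-distrib-+ (f x) _))

    sum-- : ∀ (xs : List A) (f g : A → ℤ) →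
      sumOver xs (λ x → f x - g x) ≡ sumOver xs f - sumOver xs g
    sum-- xs f g = trans (sum-+ xs f (-_ ∘ g)) (cong (λ s → sumOver xs f + s) (sum-neg xs g))

    sum-*ˡ : ∀ (xs : List A) c (f : A → ℤ) → sumOver xs (λ x → c * f x) ≡ c * sumOver xs f
    sum-*ˡ []       c f = sym (ℤ.*-zeroʳ c)
    sum-*ˡ (x ∷ xs) c f = trans (cong (λ s → c * f x + s) (sum-*ˡ xs c f)) (sym (ℤ.*-distribˡ-+ c _ _))

    sum-*ʳ : ∀ (xs : List A) c (f : A → ℤ) → sumOver xs (λ x → f x * c) ≡ sumOver xs f * c
    sum-*ʳ xs c f = trans (sum-cong xs λ x → ℤ.*-comm (f x) c)
                          (trans (sum-*ˡ xs c f) (ℤ.*-comm c _))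

    sum-++ : ∀ (xs ys : List A) (f : A → ℤ) →
      sumOver (xs ++ ys) f ≡ sumOver xs f + sumOver ys f
    sum-++ []       ys f = sym (ℤ.+-identityˡ _)
    sum-++ (x ∷ xs) ys f = trans (cong (λ s → f x + s) (sum-++ xs ys f)) (sym (ℤ.+-assoc (f x) _ _))

    -- Turning the restriction into a weight fixes the range of summation, which lets the sum over
    -- blocks be exchanged with the sum over arcs.
    sum-filter : ∀ {P : A → Set} (P? : Decidable P) xs (f : A → ℤ) →
      sumOver (filter P? xs) f ≡ sumOver xs (λ x → 𝟙 (P? x) * f x)
    sum-filter P? []       f = refl
    sum-filter P? (x ∷ xs) f with P? x
    ... | yes _ = cong₂ _+_ (sym (ℤ.*-identityˡ (f x))) (sum-filter P? xs f)
    ... | no  _ = trans (sum-filter P? xs f) (sym (ℤ.+-identityˡ _))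

    sum-nonneg : ∀ (xs : List A) {f : A → ℤ} → (∀ x → 0ℤ ≤ f x) → 0ℤ ≤ sumOver xs f
    sum-nonneg []       0≤f = ℤ.≤-refl
    sum-nonneg (x ∷ xs) 0≤f = ℤ.+-mono-≤ (0≤f x) (sum-nonneg xs 0≤f)

    term≤sum : ∀ {xs : List A} {f : A → ℤ} {x} → (∀ x → 0ℤ ≤ f x) →
      x List.∈ xs → f x ≤ sumOver xs f
    term≤sum {y ∷ xs} {f} 0≤f (here refl) =
      ℤ.≤-trans (ℤ.≤-reflexive (sym (ℤ.+-identityʳ (f y)))) (ℤ.+-monoʳ-≤ (f y) (sum-nonneg xs 0≤f))
    term≤sum {y ∷ xs} 0≤f (there x∈xs) =
      ℤ.≤-trans (ℤ.≤-reflexive (sym (ℤ.+-identityˡ _))) (ℤ.+-mono-≤ (0≤f y) (term≤sum 0≤f x∈xs))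

    sum-select : (_≟_ : DecidableEquality A) {xs : List A} {x : A} →
      Unique xs → x List.∈ xs → (f : A → ℤ) → sumOver xs (λ y → 𝟙 (y ≟ x) * f y) ≡ f x
    sum-select _≟_ {x ∷ xs} (x∉xs ∷ _) (here refl) f = begin
      𝟙 (x ≟ x) * f x + sumOver xs _   ≡⟨ cong₂ _+_ (cong (_* f x) (𝟙-yes (x ≟ x) refl)) others ⟩
      1ℤ * f x + 0ℤ                    ≡⟨ ℤ.+-identityʳ _ ⟩
      1ℤ * f x                         ≡⟨ ℤ.*-identityˡ _ ⟩
      f x                              ∎
      where
      open ≡-Reasoning
      others : sumOver xs (λ y → 𝟙 (y ≟ x) * f y) ≡ 0ℤ
      others = trans (sum-cong-∈ xs λ {y} y∈xs →
        cong (_* f y) (𝟙-no (y ≟ x) (All.lookup x∉xs y∈xs ∘ sym))) (sum-0 xs)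
    sum-select _≟_ {y ∷ xs} {x} (y∉xs ∷ u) (there x∈xs) f =
      trans (cong₂ _+_ (cong (_* f y) (𝟙-no (y ≟ x) (All.lookup y∉xs x∈xs)))
                       (sum-select _≟_ u x∈xs f))
            (ℤ.+-identityˡ _)

    -- On `xs` the indicator of `P` agrees with that of being equal to `x`, so `sum-select` applies.
    -- This turns a unique-existence statement such as the Steiner property into a count.
    sum-unique : {P : A → Set} (P? : Decidable P) (_≟_ : DecidableEquality A)
      {xs : List A} {x : A} → Unique xs → x List.∈ xs → P x →
      (∀ {y} → y List.∈ xs → P y → y ≡ x) → sumOver xs (𝟙 ∘ P?) ≡ 1ℤ
    sum-unique P? _≟_ {xs} {x} u x∈xs px only = trans
      (sum-cong-∈ xs λ {y} y∈xs → trans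
        (𝟙-cong (P? y) (y ≟ x) (only y∈xs) λ { refl → px })
        (sym (ℤ.*-identityʳ _)))
      (sum-select _≟_ u x∈xs λ _ → 1ℤ)

  sum-map : ∀ {A B : Set} (g : A → B) xs (f : B → ℤ) →
    sumOver (map g xs) f ≡ sumOver xs (f ∘ g)
  sum-map g xs f = cong (foldr _+_ 0ℤ) (sym (map-∘ xs))

  sum-concatMap : ∀ {A B : Set} (g : A → List B) xs (f : B → ℤ) →
    sumOver (concatMap g xs) f ≡ sumOver xs (λ x → sumOver (g x) f)
  sum-concatMap g []       f = refl
  sum-concatMap g (x ∷ xs) f =
    trans (sum-++ (g x) (concatMap g xs) f) (cong (λ s → sumOver (g x) f + s) (sum-concatMap g xs f))

  sum-swap : ∀ {A B : Set} (xs : List A) (ys : List B) (f : A → B → ℤ) →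
    sumOver xs (λ x → sumOver ys (f x)) ≡ sumOver ys (λ y → sumOver xs λ x → f x y)
  sum-swap []       ys f = sym (sum-0 ys)
  sum-swap (x ∷ xs) ys f =
    trans (cong (λ s → sumOver ys (f x) + s) (sum-swap xs ys f)) (sym (sum-+ ys (f x) _))

-- Pairs, triples, and the listing of all subsets of a given size.

module Subsets where
  open import Data.Integer.Base using (_+_; _*_)
  open Sums

  ∈-pair⁻ : ∀ {v} {w} (x y : Fin v) → w ∈ ⁅ x ⁆ ∪ ⁅ y ⁆ → w ≡ x ⊎ w ≡ y
  ∈-pair⁻ x y w∈ with x∈p∪q⁻ ⁅ x ⁆ ⁅ y ⁆ w∈
  ... | inj₁ w∈x = inj₁ (x∈⁅y⁆⇒x≡y x w∈x)
  ... | inj₂ w∈y = inj₂ (x∈⁅y⁆⇒x≡y y w∈y)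

  ∈-triple⁻ : ∀ {v} {w} (x y z : Fin v) → w ∈ ⁅ x ⁆ ∪ ⁅ y ⁆ ∪ ⁅ z ⁆ → w ≡ x ⊎ w ≡ y ⊎ w ≡ z
  ∈-triple⁻ x y z w∈ with x∈p∪q⁻ ⁅ x ⁆ _ w∈
  ... | inj₁ w∈x  = inj₁ (x∈⁅y⁆⇒x≡y x w∈x)
  ... | inj₂ w∈yz = inj₂ (∈-pair⁻ y z w∈yz)

  module _ {v : ℕ} where

    ∈-pair₁ : (x y : Fin v) → x ∈ ⁅ x ⁆ ∪ ⁅ y ⁆
    ∈-pair₁ x y = p⊆p∪q ⁅ y ⁆ (x∈⁅x⁆ x)

    ∈-pair₂ : (x y : Fin v) → y ∈ ⁅ x ⁆ ∪ ⁅ y ⁆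
    ∈-pair₂ x y = q⊆p∪q ⁅ x ⁆ ⁅ y ⁆ (x∈⁅x⁆ y)

    ∈-triple₁ : (x y z : Fin v) → x ∈ ⁅ x ⁆ ∪ ⁅ y ⁆ ∪ ⁅ z ⁆
    ∈-triple₁ x y z = p⊆p∪q _ (x∈⁅x⁆ x)

    ∈-triple₂ : (x y z : Fin v) → y ∈ ⁅ x ⁆ ∪ ⁅ y ⁆ ∪ ⁅ z ⁆
    ∈-triple₂ x y z = q⊆p∪q ⁅ x ⁆ _ (∈-pair₁ y z)

    ∈-triple₃ : (x y z : Fin v) → z ∈ ⁅ x ⁆ ∪ ⁅ y ⁆ ∪ ⁅ z ⁆
    ∈-triple₃ x y z = q⊆p∪q ⁅ x ⁆ _ (∈-pair₂ y z)

    pair⊆ : ∀ {x y : Fin v} {p} → x ∈ p → y ∈ p → ⁅ x ⁆ ∪ ⁅ y ⁆ ⊆ p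
    pair⊆ {x} {y} x∈p y∈p w∈ with ∈-pair⁻ x y w∈
    ... | inj₁ refl = x∈p
    ... | inj₂ refl = y∈p

    triple⊆ : ∀ {x y z : Fin v} {p} → x ∈ p → y ∈ p → z ∈ p → ⁅ x ⁆ ∪ ⁅ y ⁆ ∪ ⁅ z ⁆ ⊆ p
    triple⊆ {x} {y} {z} x∈p y∈p z∈p w∈ with ∈-triple⁻ x y z w∈
    ... | inj₁ refl        = x∈p
    ... | inj₂ (inj₁ refl) = y∈p
    ... | inj₂ (inj₂ refl) = z∈p

  ∣⁅x⁆∪p∣≡1+∣p∣ : ∀ {v} {x : Fin v} {p} → x ∉ p → ∣ ⁅ x ⁆ ∪ p ∣ ≡ suc ∣ p ∣
  ∣⁅x⁆∪p∣≡1+∣p∣ {x = zero}  {inside  Vec.∷ p} x∉p = contradiction Vec.here x∉p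
  ∣⁅x⁆∪p∣≡1+∣p∣ {x = zero}  {outside Vec.∷ p} x∉p = cong (suc ∘ ∣_∣) (∪-identityˡ p)
  ∣⁅x⁆∪p∣≡1+∣p∣ {x = suc x} {inside  Vec.∷ p} x∉p = cong suc (∣⁅x⁆∪p∣≡1+∣p∣ (x∉p ∘ Vec.there))
  ∣⁅x⁆∪p∣≡1+∣p∣ {x = suc x} {outside Vec.∷ p} x∉p = ∣⁅x⁆∪p∣≡1+∣p∣ (x∉p ∘ Vec.there)

  module _ {v : ℕ} where

    ∣pair∣ : ∀ {x y : Fin v} → x ≢ y → ∣ ⁅ x ⁆ ∪ ⁅ y ⁆ ∣ ≡ 2
    ∣pair∣ {y = y} x≢y = trans (∣⁅x⁆∪p∣≡1+∣p∣ (x≢y⇒x∉⁅y⁆ x≢y)) (cong suc (∣⁅x⁆∣≡1 y))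

    ∣triple∣ : ∀ {x y z : Fin v} → x ≢ y → x ≢ z → y ≢ z → ∣ ⁅ x ⁆ ∪ ⁅ y ⁆ ∪ ⁅ z ⁆ ∣ ≡ 3
    ∣triple∣ {y = y} {z} x≢y x≢z y≢z =
      trans (∣⁅x⁆∪p∣≡1+∣p∣ ([ x≢y , x≢z ]′ ∘ ∈-pair⁻ y z)) (cong suc (∣pair∣ y≢z))

    ∣pair∣≤2 : (x y : Fin v) → ∣ ⁅ x ⁆ ∪ ⁅ y ⁆ ∣ ℕ.≤ 2
    ∣pair∣≤2 x y with x ∈? ⁅ y ⁆
    ... | no  x∉y = ℕ.≤-reflexive (∣pair∣ {x} {y} λ { refl → x∉y (x∈⁅x⁆ x) })
    ... | yes x∈y = ℕ.≤-trans (p⊆q⇒∣p∣≤∣q∣ (pair⊆ x∈y (x∈⁅x⁆ y)))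
                              (ℕ.≤-trans (ℕ.≤-reflexive (∣⁅x⁆∣≡1 y)) (s≤s z≤n))

    ∣pair∣≡2⇒≢ : ∀ {x y : Fin v} → ∣ ⁅ x ⁆ ∪ ⁅ y ⁆ ∣ ≡ 2 → x ≢ y
    ∣pair∣≡2⇒≢ {x} eq refl = contradiction
      (subst (ℕ._≤ 1) eq (ℕ.≤-trans (p⊆q⇒∣p∣≤∣q∣ (pair⊆ (x∈⁅x⁆ x) (x∈⁅x⁆ x)))
                                  (ℕ.≤-reflexive (∣⁅x⁆∣≡1 x))))
      λ { (s≤s ()) }

    -- Pigeonhole: otherwise a set of size 3 would sit inside one of size at most 2.
    ∣triple∣≡3⇒⊈pair : ∀ {x y z w u : Fin v} → ∣ ⁅ x ⁆ ∪ ⁅ y ⁆ ∪ ⁅ z ⁆ ∣ ≡ 3 →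
      x ∈ ⁅ w ⁆ ∪ ⁅ u ⁆ → y ∈ ⁅ w ⁆ ∪ ⁅ u ⁆ → z ∉ ⁅ w ⁆ ∪ ⁅ u ⁆
    ∣triple∣≡3⇒⊈pair {w = w} {u} eq x∈ y∈ z∈ = ℕ.<-irrefl refl
      (ℕ.≤-trans (ℕ.≤-trans (ℕ.≤-reflexive (sym eq)) (p⊆q⇒∣p∣≤∣q∣ (triple⊆ x∈ y∈ z∈)))
                 (∣pair∣≤2 w u))

    ∣triple∣≡3⇒distinct : ∀ {x y z : Fin v} → ∣ ⁅ x ⁆ ∪ ⁅ y ⁆ ∪ ⁅ z ⁆ ∣ ≡ 3 →
      x ≢ y × x ≢ z × y ≢ z
    ∣triple∣≡3⇒distinct {x} {y} {z} eq =
      (λ { refl → ∣triple∣≡3⇒⊈pair eq (∈-pair₁ x z) (∈-pair₁ x z) (∈-pair₂ x z) }) ,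
      (λ { refl → ∣triple∣≡3⇒⊈pair eq (∈-pair₁ x y) (∈-pair₂ x y) (∈-pair₁ x y) }) ,
      (λ { refl → ∣triple∣≡3⇒⊈pair eq (∈-pair₁ x y) (∈-pair₂ x y) (∈-pair₂ x y) })

    -- A further point of `p` would make the pair a proper subset of `p`, although both have two
    -- elements.
    ⊆-pair : ∀ {x y : Fin v} {p} → ∣ p ∣ ≡ 2 → x ≢ y → x ∈ p → y ∈ p → p ⊆ ⁅ x ⁆ ∪ ⁅ y ⁆
    ⊆-pair {x} {y} ∣p∣≡2 x≢y x∈p y∈p {w} w∈p with w ∈? ⁅ x ⁆ ∪ ⁅ y ⁆
    ... | yes w∈ = w∈
    ... | no  w∉ = contradiction (p⊂q⇒∣p∣<∣q∣ (pair⊆ x∈p y∈p , w , w∈p , w∉))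
                                 (ℕ.<-irrefl (trans (∣pair∣ x≢y) (sym ∣p∣≡2)))

    ∣p∣≡2⇒⊈⁅x⁆ : ∀ {p : Subset v} → ∣ p ∣ ≡ 2 → (x : Fin v) → ¬ (∀ {w} → w ∈ p → w ≡ x)
    ∣p∣≡2⇒⊈⁅x⁆ {p} ∣p∣≡2 x p⊆x = contradiction
      (subst₂ ℕ._≤_ ∣p∣≡2 (∣⁅x⁆∣≡1 x)
        (p⊆q⇒∣p∣≤∣q∣ {p = p} {⁅ x ⁆} λ w∈p → subst (_∈ ⁅ x ⁆) (sym (p⊆x w∈p)) (x∈⁅x⁆ x)))
      λ { (s≤s ()) }

    member : Subset v → Fin v → ℤ
    member p x = 𝟙 (x ∈? p)

    -- A 2-set inside xyz is one of xy, xz, yz, and each product detects one of these; no two can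
    -- hold together. The polynomial form reduces the balance condition to a ring identity.
    𝟙-⊆-triple : ∀ {A : Subset v} {x y z} → ∣ A ∣ ≡ 2 → x ≢ y → x ≢ z → y ≢ z →
      𝟙 (A ⊆? (⁅ x ⁆ ∪ ⁅ y ⁆ ∪ ⁅ z ⁆)) ≡
      member A x * member A y + member A x * member A z + member A y * member A z
    𝟙-⊆-triple {A} {x} {y} {z} ∣A∣≡2 x≢y x≢z y≢z with x ∈? A | y ∈? A | z ∈? A
    -- Impossible: x and y already exhaust `A`, so z would coincide with one of them.
    ... | yes x∈ | yes y∈ | yes z∈ =
      contradiction (∈-pair⁻ x y (⊆-pair ∣A∣≡2 x≢y x∈ y∈ z∈)) [ x≢z ∘ sym , y≢z ∘ sym ]′
    ... | yes x∈ | yes y∈ | no  z∉ = 𝟙-yes (A ⊆? _)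
      (pair⊆ (∈-triple₁ x y z) (∈-triple₂ x y z) ∘ ⊆-pair ∣A∣≡2 x≢y x∈ y∈)
    ... | yes x∈ | no  y∉ | yes z∈ = 𝟙-yes (A ⊆? _)
      (pair⊆ (∈-triple₁ x y z) (∈-triple₃ x y z) ∘ ⊆-pair ∣A∣≡2 x≢z x∈ z∈)
    ... | no  x∉ | yes y∈ | yes z∈ = 𝟙-yes (A ⊆? _)
      (pair⊆ (∈-triple₂ x y z) (∈-triple₃ x y z) ∘ ⊆-pair ∣A∣≡2 y≢z y∈ z∈)
    ... | yes x∈ | no  y∉ | no  z∉ = 𝟙-no (A ⊆? _) λ A⊆ →
      ∣p∣≡2⇒⊈⁅x⁆ ∣A∣≡2 x λ {w} w∈ → [ id , [ (λ { refl → contradiction w∈ y∉ }) ,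
        (λ { refl → contradiction w∈ z∉ }) ]′ ]′ (∈-triple⁻ x y z (A⊆ w∈))
    ... | no  x∉ | yes y∈ | no  z∉ = 𝟙-no (A ⊆? _) λ A⊆ →
      ∣p∣≡2⇒⊈⁅x⁆ ∣A∣≡2 y λ {w} w∈ → [ (λ { refl → contradiction w∈ x∉ }) ,
        [ id , (λ { refl → contradiction w∈ z∉ }) ]′ ]′ (∈-triple⁻ x y z (A⊆ w∈))
    ... | no  x∉ | no  y∉ | _ = 𝟙-no (A ⊆? _) λ A⊆ →
      ∣p∣≡2⇒⊈⁅x⁆ ∣A∣≡2 z λ {w} w∈ → [ (λ { refl → contradiction w∈ x∉ }) ,
        [ (λ { refl → contradiction w∈ y∉ }) , id ]′ ]′ (∈-triple⁻ x y z (A⊆ w∈))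

  -- The cardinality proofs are dropped because `block` compares bare subsets; uniqueness and
  -- membership are therefore needed for the subsets alone.
  underlying : ∀ v k → List (Subset v)
  underlying v k = map proj₁ (kSubsets v k)

  underlying-zero : ∀ v → underlying (suc v) zero ≡ map (outside Vec.∷_) (underlying v zero)
  underlying-zero v = trans (sym (map-∘ (kSubsets v zero))) (map-∘ (kSubsets v zero))

  underlying-suc : ∀ v k → underlying (suc v) (suc k) ≡
    map (inside Vec.∷_) (underlying v k) ++ map (outside Vec.∷_) (underlying v (suc k))
  underlying-suc v k = trans (map-++ proj₁ (map _ (kSubsets v k)) _) (cong₂ _++_
    (trans (sym (map-∘ (kSubsets v k))) (map-∘ (kSubsets v k)))
    (trans (sym (map-∘ (kSubsets v (suc k)))) (map-∘ (kSubsets v (suc k)))))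

  underlying-unique : ∀ v k → Unique (underlying v k)
  underlying-unique zero    zero    = [] ∷ []
  underlying-unique zero    (suc k) = []
  underlying-unique (suc v) zero    = subst Unique (sym (underlying-zero v))
    (Unique.map⁺ Vec.∷-injectiveʳ (underlying-unique v zero))
  underlying-unique (suc v) (suc k) = subst Unique (sym (underlying-suc v k))
    (Unique.++⁺ (Unique.map⁺ Vec.∷-injectiveʳ (underlying-unique v k))
                (Unique.map⁺ Vec.∷-injectiveʳ (underlying-unique v (suc k)))
                λ (i∈ , o∈) → disjoint (∈-map⁻ _ i∈) (∈-map⁻ _ o∈))
    where
    disjoint : ∀ {S : Subset (suc v)} {xs ys : List (Subset v)} →
      ∃ (λ p → p List.∈ xs × S ≡ inside Vec.∷ p) →
      ∃ (λ p → p List.∈ ys × S ≡ outside Vec.∷ p) → ⊥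
    disjoint (_ , _ , refl) (_ , _ , ())

  ∈-underlying : ∀ {v} k (S : Subset v) → ∣ S ∣ ≡ k → S List.∈ underlying v k
  ∈-underlying zero    Vec.[]              refl = here refl
  ∈-underlying {suc v} zero    (outside Vec.∷ S) eq =
    subst (outside Vec.∷ S List.∈_) (sym (underlying-zero v)) (∈-map⁺ _ (∈-underlying zero S eq))
  ∈-underlying {suc v} (suc k) (outside Vec.∷ S) eq =
    subst (outside Vec.∷ S List.∈_) (sym (underlying-suc v k))
      (∈-++⁺ʳ _ (∈-map⁺ _ (∈-underlying (suc k) S eq)))
  ∈-underlying {suc v} (suc k) (inside Vec.∷ S) eq =
    subst (inside Vec.∷ S List.∈_) (sym (underlying-suc v k))
      (∈-++⁺ˡ (∈-map⁺ _ (∈-underlying k S (ℕ.suc-injective eq))))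

  -- A block is a delta function at xyz, which has size 3 by distinctness and so occurs exactly once
  -- in the listing.
  sum-block : ∀ {v} {x y z : Fin v} → x ≢ y → x ≢ z → y ≢ z → (f : Subset v → ℤ) →
    sumOver (kSubsets v 3) (λ B → block x y z B * f (proj₁ B)) ≡ f (⁅ x ⁆ ∪ ⁅ y ⁆ ∪ ⁅ z ⁆)
  sum-block {v} x≢y x≢z y≢z f = trans
    (sym (sum-map proj₁ (kSubsets v 3) _))
    (sum-select _≟ˢ_ (underlying-unique v 3) (∈-underlying 3 _ (∣triple∣ x≢y x≢z y≢z)) f)

-- Lists of arcs: counting in tournaments.

module Tournaments where
  open import Data.Integer.Base using (_+_; _-_; -_; _*_; _≤_; _⊔_)
  open Sums
  open Subsets

  Arcs : ℕ → Set
  Arcs l = List (Fin l × Fin l)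

  -- Supplies, from a sign that is present at a block, an arc responsible for it.
  sum≡0⊎nonzero-term : ∀ {A : Set} (xs : List A) (f : A → ℤ) →
    sumOver xs f ≡ 0ℤ ⊎ ∃ λ x → x List.∈ xs × f x ≢ 0ℤ
  sum≡0⊎nonzero-term []       f = inj₁ refl
  sum≡0⊎nonzero-term (x ∷ xs) f with f x ℤ.≟ 0ℤ | sum≡0⊎nonzero-term xs f
  ... | no  fx≢0 | _                        = inj₂ (x , here refl , fx≢0)
  ... | yes fx≡0 | inj₁ eq                  = inj₁ (cong₂ _+_ fx≡0 eq)
  ... | yes fx≡0 | inj₂ (y , y∈xs , fy≢0) = inj₂ (y , there y∈xs , fy≢0)

  sum-1≡length : ∀ {A : Set} (xs : List A) → sumOver xs (λ _ → 1ℤ) ≡ + length xs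
  sum-1≡length []       = refl
  sum-1≡length (x ∷ xs) = cong (λ n → 1ℤ + n) (sum-1≡length xs)

  module _ {l : ℕ} where

    sum-allFin-1 : sumOver (allFin l) (λ _ → 1ℤ) ≡ + l
    sum-allFin-1 = trans (sum-1≡length (allFin l)) (cong +_ (length-tabulate id))

    sum-allFin-≟ˡ : ∀ (p : Fin l) → sumOver (allFin l) (λ q → 𝟙 (q ≟ p)) ≡ 1ℤ
    sum-allFin-≟ˡ p = sum-unique (_≟ p) _≟_ (Unique.allFin⁺ l) (∈-allFin p) refl λ _ → id

    sum-allFin-≟ʳ : ∀ (p : Fin l) → sumOver (allFin l) (λ q → 𝟙 (p ≟ q)) ≡ 1ℤ
    sum-allFin-≟ʳ p = sum-unique (p ≟_) _≟_ (Unique.allFin⁺ l) (∈-allFin p) refl λ _ → sym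

  -- Induction by Pascal's rule. The form without division or subtraction matches `size+size+l≡l*l`.
  2*nC2+n≡n*n : ∀ n → 2 ℕ.* (n C 2) ℕ.+ n ≡ n ℕ.* n
  2*nC2+n≡n*n zero    = refl
  2*nC2+n≡n*n (suc n) = begin
    2 ℕ.* (suc n C 2) ℕ.+ suc n           ≡⟨ cong (λ m → 2 ℕ.* m ℕ.+ suc n)
                                               (sym (nCk+nC[k+1]≡[n+1]C[k+1] n 1)) ⟩
    2 ℕ.* (n C 1 ℕ.+ n C 2) ℕ.+ suc n     ≡⟨ cong (λ m → 2 ℕ.* (m ℕ.+ n C 2) ℕ.+ suc n) (nC1≡n n) ⟩
    2 ℕ.* (n ℕ.+ n C 2) ℕ.+ suc n         ≡⟨ regroup n (n C 2) ⟩
    2 ℕ.* (n C 2) ℕ.+ n ℕ.+ (n ℕ.+ suc n) ≡⟨ cong (ℕ._+ (n ℕ.+ suc n)) (2*nC2+n≡n*n n) ⟩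
    n ℕ.* n ℕ.+ (n ℕ.+ suc n)             ≡⟨ square n ⟩
    suc n ℕ.* suc n                       ∎
    where
    open ≡-Reasoning
    regroup : ∀ n c → 2 ℕ.* (n ℕ.+ c) ℕ.+ suc n ≡ 2 ℕ.* c ℕ.+ n ℕ.+ (n ℕ.+ suc n)
    regroup = ℕ-Solver.solve-∀
    square : ∀ n → n ℕ.* n ℕ.+ (n ℕ.+ suc n) ≡ suc n ℕ.* suc n
    square = ℕ-Solver.solve-∀

  module _ {l : ℕ} (E : Arcs l) where

    multiplicity : Fin l → Fin l → ℤ
    multiplicity p q = sumOver E λ (i , j) → 𝟙 (p ≟ i) * 𝟙 (q ≟ j)

    -- The indicator covers the diagonal: at p = q the equation says that twice the number of loops
    -- at p, plus 1, is 1, so there are no loops.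
    Tournament : Set
    Tournament = ∀ p q → multiplicity p q + multiplicity q p + 𝟙 (p ≟ q) ≡ 1ℤ

    -- Taking φ to be the indicator of a vertex gives equal in-degree and out-degree there. The
    -- version with an arbitrary potential is the one that the balance condition consumes.
    Eulerian : Set
    Eulerian = ∀ (φ : Fin l → ℤ) → sumOver E (λ (i , j) → φ i - φ j) ≡ 0ℤ

    module _ (tournament : Tournament) where

      -- Both arcs together would bring the tournament equation at (i , j) to at least 2. The case i
      -- = j is included and yields `loopless`.
      no-reverse : ∀ {i j} → (i , j) List.∈ E → ¬ (j , i) List.∈ E
      no-reverse {i} {j} ij∈E ji∈E = contradiction
        (subst (+ 2 ≤_) (tournament i j)
          (ℤ.+-mono-≤ (ℤ.+-mono-≤ (occurs ij∈E) (occurs ji∈E)) (𝟙-nonneg (i ≟ j))))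
        λ { (+≤+ (s≤s ())) }
        where
        𝟙*𝟙-nonneg : ∀ (p q i j : Fin l) → 0ℤ ≤ 𝟙 (p ≟ i) * 𝟙 (q ≟ j)
        𝟙*𝟙-nonneg p q i j with p ≟ i | q ≟ j
        ... | yes _ | yes _ = +≤+ z≤n
        ... | yes _ | no  _ = +≤+ z≤n
        ... | no  _ | yes _ = +≤+ z≤n
        ... | no  _ | no  _ = +≤+ z≤n
        occurs : ∀ {p q} → (p , q) List.∈ E → 1ℤ ≤ multiplicity p q
        occurs {p} {q} pq∈E = ℤ.≤-trans
          (ℤ.≤-reflexive (sym (cong₂ _*_ (𝟙-yes (p ≟ p) refl) (𝟙-yes (q ≟ q) refl))))
          (term≤sum {f = λ (i , j) → 𝟙 (p ≟ i) * 𝟙 (q ≟ j)} (λ (i , j) → 𝟙*𝟙-nonneg p q i j) pq∈E)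

      loopless : ∀ {i j} → (i , j) List.∈ E → i ≢ j
      loopless ii∈E refl = no-reverse ii∈E ii∈E

      private
        V = allFin l
        size = sumOver E λ _ → 1ℤ

      -- Double counting: each arc is found at exactly one ordered pair of vertices.
      sum-multiplicity : sumOver V (λ p → sumOver V (multiplicity p)) ≡ size
      sum-multiplicity = begin
        sumOver V (λ p → sumOver V λ q → sumOver E λ (i , j) → 𝟙 (p ≟ i) * 𝟙 (q ≟ j))
          ≡⟨ (sum-cong V λ p → sum-swap V E _) ⟩
        sumOver V (λ p → sumOver E λ (i , j) → sumOver V λ q → 𝟙 (p ≟ i) * 𝟙 (q ≟ j))
          ≡⟨ (sum-cong V λ p → sum-cong E λ (i , j) → trans
               (sum-*ˡ V (𝟙 (p ≟ i)) _)
               (trans (cong (𝟙 (p ≟ i) *_) (sum-allFin-≟ˡ j)) (ℤ.*-identityʳ _))) ⟩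
        sumOver V (λ p → sumOver E λ (i , j) → 𝟙 (p ≟ i))
          ≡⟨ sum-swap V E _ ⟩
        sumOver E (λ (i , j) → sumOver V λ p → 𝟙 (p ≟ i))
          ≡⟨ (sum-cong E λ (i , j) → sum-allFin-≟ˡ i) ⟩
        size ∎
        where open ≡-Reasoning

      -- The tournament equation summed over all l² ordered pairs: every arc is seen from both ends,
      -- and the diagonal adds l.
      size+size+l≡l*l : size + size + + l ≡ + l * + l
      size+size+l≡l*l = begin
        size + size + + l
          ≡⟨ sym (cong₂ _+_ (cong₂ _+_ sum-multiplicity
                               (trans (sum-swap V V _) sum-multiplicity))
                            (trans (sum-cong V sum-allFin-≟ʳ) sum-allFin-1)) ⟩
        sumOver V (λ p → sumOver V λ q → multiplicity p q) +
        sumOver V (λ p → sumOver V λ q → multiplicity q p) +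
        sumOver V (λ p → sumOver V λ q → 𝟙 (p ≟ q))
          ≡⟨ sym (trans (sum-cong V λ p → trans (sum-+ V _ _) (cong (_+ _) (sum-+ V _ _)))
                        (trans (sum-+ V _ _) (cong (_+ _) (sum-+ V _ _)))) ⟩
        sumOver V (λ p → sumOver V λ q → multiplicity p q + multiplicity q p + 𝟙 (p ≟ q))
          ≡⟨ (sum-cong V λ p → trans (sum-cong V (tournament p)) sum-allFin-1) ⟩
        sumOver V (λ p → + l)
          ≡⟨ (sum-cong V λ p → sym (ℤ.*-identityʳ (+ l))) ⟩
        sumOver V (λ p → + l * 1ℤ)
          ≡⟨ trans (sum-*ˡ V (+ l) _) (cong (+ l *_) sum-allFin-1) ⟩
        + l * + l ∎
        where open ≡-Reasoning

      sum-2≡2*lC2 : sumOver E (λ _ → + 2) ≡ + (2 ℕ.* (l C 2))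
      sum-2≡2*lC2 = trans (sum-+ E _ _) (AbelianGroup.∙-cancelʳ ℤ.+-0-abelianGroup (+ l) _ _ (begin
        size + size + + l              ≡⟨ size+size+l≡l*l ⟩
        + l * + l                      ≡⟨ sym (ℤ.pos-* l l) ⟩
        + (l ℕ.* l)                    ≡⟨ cong +_ (sym (2*nC2+n≡n*n l)) ⟩
        + (2 ℕ.* (l C 2) ℕ.+ l)        ≡⟨ ℤ.pos-+ (2 ℕ.* (l C 2)) l ⟩
        + (2 ℕ.* (l C 2)) + + l        ∎))
        where open ≡-Reasoning

  difference-⊔-0 : ∀ {p n} → 0ℤ ≤ p → 0ℤ ≤ n → p ≡ 0ℤ ⊎ n ≡ 0ℤ → (p - n) ⊔ 0ℤ ≡ p
  difference-⊔-0 {n = n} _ 0≤n (inj₁ refl) =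
    ℤ.i≤j⇒i⊔j≡j (subst (_≤ 0ℤ) (sym (ℤ.+-identityˡ (- n))) (ℤ.neg-mono-≤ 0≤n))
  difference-⊔-0 {p} 0≤p _ (inj₂ refl) =
    trans (cong (_⊔ 0ℤ) (ℤ.+-identityʳ p)) (ℤ.i≥j⇒i⊔j≡i 0≤p)

  -- Signed blocks of arcs: volume and balance.

  module _ {v l : ℕ} {a b : Fin l → Fin v} (labelling : IsLabelling a b) where
    open IsLabelling labelling

    -- The Boolean selects the class of the point, so that the blocks aᵢbᵢaⱼ and aᵢbᵢbⱼ are handled
    -- together.
    point : Bool → Fin l → Fin v
    point false = a
    point true  = b

    point-injective : ∀ s t {i j} → point s i ≡ point t j → s ≡ t × i ≡ j
    point-injective false false eq = refl , a-injective eq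
    point-injective true  true  eq = refl , b-injective eq
    point-injective false true  eq = contradiction eq (disjoint _ _)
    point-injective true  false eq = contradiction (sym eq) (disjoint _ _)

    flag : Fin l → Bool → Fin l → Subset v
    flag i s j = ⁅ a i ⁆ ∪ ⁅ b i ⁆ ∪ ⁅ point s j ⁆

    ∈-flag⁻ : ∀ s {i t j k} → point s k ∈ flag i t j → k ≡ i ⊎ s ≡ t × k ≡ j
    ∈-flag⁻ s {i} {t} {j} x∈ with ∈-triple⁻ (a i) (b i) (point t j) x∈
    ... | inj₁ eq        = inj₁ (proj₂ (point-injective s false eq))
    ... | inj₂ (inj₁ eq) = inj₁ (proj₂ (point-injective s true eq))
    ... | inj₂ (inj₂ eq) = inj₂ (point-injective s t eq)

    -- A block determines its arc: the tail is the index both of whose points lie in the block, and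
    -- the head is the index of the remaining point.
    flag-injective : ∀ {i s j p t q} → p ≢ q → flag i s j ≡ flag p t q → i ≡ p × j ≡ q
    flag-injective {i} {s} {j} {p} {t} {q} p≢q eq = sym p≡i , sym q≡j
      where
      p≡i : p ≡ i
      p≡i with ∈-flag⁻ false (subst (a p ∈_) (sym eq) (∈-triple₁ (a p) (b p) (point t q)))
             | ∈-flag⁻ true  (subst (b p ∈_) (sym eq) (∈-triple₂ (a p) (b p) (point t q)))
      ... | inj₁ p≡i        | _               = p≡i
      ... | _               | inj₁ p≡i        = p≡i
      -- If neither aₚ nor bₚ had index i, the one remaining point would belong to both classes.
      ... | inj₂ (refl , _) | inj₂ (() , _)
      q≡j : q ≡ j
      q≡j with ∈-flag⁻ t (subst (point t q ∈_) (sym eq) (∈-triple₃ (a p) (b p) (point t q)))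
      ... | inj₁ q≡i       = contradiction (trans p≡i (sym q≡i)) p≢q
      ... | inj₂ (_ , q≡j) = q≡j

    -- The two blocks that the arc (i , j) contributes positively; those it
    -- contributes negatively are the blocks of out j i.
    out : Fin l → Fin l → FormalSum v 3
    out i j B = block (a i) (b i) (a j) B + block (a i) (b i) (b j) B

    out-nonneg : ∀ i j B → 0ℤ ≤ out i j B
    out-nonneg i j (B , _) = ℤ.+-mono-≤ (𝟙-nonneg (B ≟ˢ _)) (𝟙-nonneg (B ≟ˢ _))

    out≢0⇒flag : ∀ i j B → out i j B ≢ 0ℤ → ∃ λ s → proj₁ B ≡ flag i s j
    out≢0⇒flag i j (B , _) ≢0 with B ≟ˢ flag i false j | B ≟ˢ flag i true j
    ... | yes eq | _      = false , eq
    ... | no  _  | yes eq = true , eq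
    ... | no  _  | no  _  = contradiction refl ≢0

    -- The weight `f` is left free: the constant 1 serves the volume, and the indicator of
    -- containing `A` serves the balance.
    sum-out : ∀ {i j} → i ≢ j → (f : Subset v → ℤ) →
      sumOver (kSubsets v 3) (λ B → out i j B * f (proj₁ B)) ≡ f (flag i false j) + f (flag i true j)
    sum-out {i} {j} i≢j f = begin
      sumOver K (λ B → out i j B * f (proj₁ B))
        ≡⟨ (sum-cong K λ B → ℤ.*-distribʳ-+ (f (proj₁ B)) (block (a i) (b i) (a j) B) _) ⟩
      sumOver K (λ B → block (a i) (b i) (a j) B * f (proj₁ B) +
                       block (a i) (b i) (b j) B * f (proj₁ B))
        ≡⟨ sum-+ K _ _ ⟩
      sumOver K (λ B → block (a i) (b i) (a j) B * f (proj₁ B)) +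
      sumOver K (λ B → block (a i) (b i) (b j) B * f (proj₁ B))
        ≡⟨ cong₂ _+_
             (sum-block (disjoint i i) (i≢j ∘ a-injective) (disjoint j i ∘ sym) f)
             (sum-block (disjoint i i) (disjoint i j) (i≢j ∘ b-injective) f) ⟩
      f (flag i false j) + f (flag i true j) ∎
      where
      open ≡-Reasoning
      K = kSubsets v 3

    module _ {E : Arcs l} (tournament : Tournament E) where
      private K = kSubsets v 3

      -- The positive and negative contributions before any cancellation. They turn out to be the
      -- legs because no block occurs in both.
      f⁺ f⁻ : FormalSum v 3
      f⁺ B = sumOver E λ (i , j) → out i j B
      f⁻ B = sumOver E λ (i , j) → out j i B

      -- A block with both signs comes positively from an arc (i , j) and negatively from an arc (p
      -- , q). By `flag-injective` these are reverses of each other, against `no-reverse`.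
      f⁺≡0⊎f⁻≡0 : ∀ B → f⁺ B ≡ 0ℤ ⊎ f⁻ B ≡ 0ℤ
      f⁺≡0⊎f⁻≡0 B with sum≡0⊎nonzero-term E (λ (i , j) → out i j B)
                     | sum≡0⊎nonzero-term E (λ (i , j) → out j i B)
      ... | inj₁ eq | _       = inj₁ eq
      ... | _       | inj₁ eq = inj₂ eq
      ... | inj₂ ((i , j) , ij∈E , ij≢0) | inj₂ ((p , q) , pq∈E , qp≢0)
        with out≢0⇒flag i j B ij≢0 | out≢0⇒flag q p B qp≢0
      ... | s , B≡ijs | t , B≡qpt
        with flag-injective {s = s} {t = t} (loopless E tournament pq∈E ∘ sym) (trans (sym B≡ijs) B≡qpt)
      ... | refl , refl = contradiction pq∈E (no-reverse E tournament ij∈E)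

      sum-f⁺ : sumOver K f⁺ ≡ + (2 ℕ.* (l C 2))
      sum-f⁺ = trans (sum-swap K E _) (trans
        (sum-cong-∈ E λ {(i , j)} ij∈E → trans
          (sum-cong K λ B → sym (ℤ.*-identityʳ (out i j B)))
          (sum-out (loopless E tournament ij∈E) λ _ → 1ℤ))
        (sum-2≡2*lC2 E tournament))

      sum-f⁻ : sumOver K f⁻ ≡ + (2 ℕ.* (l C 2))
      sum-f⁻ = trans (sum-swap K E _) (trans
        (sum-cong-∈ E λ {(i , j)} ij∈E → trans
          (sum-cong K λ B → sym (ℤ.*-identityʳ (out j i B)))
          (sum-out (loopless E tournament ij∈E ∘ sym) λ _ → 1ℤ))
        (sum-2≡2*lC2 E tournament))

      module _ {f : FormalSum v 3} (f≡sum : ∀ B → f B ≡ sumOver E λ (i , j) → edge a b i j B) where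

        f≡f⁺-f⁻ : ∀ B → f B ≡ f⁺ B - f⁻ B
        f≡f⁺-f⁻ B = trans (f≡sum B) (sum-- E _ _)

        tournament⇒volume : HasVolume f (2 ℕ.* (l C 2))
        tournament⇒volume = trans (sum-cong K leg₀≡f⁺) sum-f⁺ , trans (sum-cong K leg₁≡f⁻) sum-f⁻
          where
          f⁺-nonneg : ∀ B → 0ℤ ≤ f⁺ B
          f⁺-nonneg B = sum-nonneg E λ (i , j) → out-nonneg i j B
          f⁻-nonneg : ∀ B → 0ℤ ≤ f⁻ B
          f⁻-nonneg B = sum-nonneg E λ (i , j) → out-nonneg j i B
          neg-difference : ∀ p n → - (p - n) ≡ n - p
          neg-difference = solve-∀
          leg₀≡f⁺ : ∀ B → leg₀ f B ≡ f⁺ B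
          leg₀≡f⁺ B = trans (cong (_⊔ 0ℤ) (f≡f⁺-f⁻ B))
            (difference-⊔-0 (f⁺-nonneg B) (f⁻-nonneg B) (f⁺≡0⊎f⁻≡0 B))
          leg₁≡f⁻ : ∀ B → leg₁ f B ≡ f⁻ B
          leg₁≡f⁻ B = trans
            (cong (_⊔ 0ℤ) (trans (cong -_ (f≡f⁺-f⁻ B)) (neg-difference (f⁺ B) (f⁻ B))))
            (difference-⊔-0 (f⁻-nonneg B) (f⁺-nonneg B) (Sum.swap (f⁺≡0⊎f⁻≡0 B)))

        module _ (eulerian : Eulerian E) where

          -- Among the blocks of an arc (i , j), a pair A other than aᵢbᵢ and
          -- aⱼbⱼ is covered equally often with either sign.
          eulerian⇒balanced : ∀ (A : KSubset v 2) →
            sumOver (filter (λ B → proj₁ A ⊆? proj₁ B) K) f ≡ 0ℤ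
          eulerian⇒balanced (A , ∣A∣≡2) = begin
            sumOver (filter (λ B → A ⊆? proj₁ B) K) f
              ≡⟨ sum-filter _ K f ⟩
            sumOver K (λ B → 𝟙 (A ⊆? proj₁ B) * f B)
              ≡⟨ (sum-cong K λ B → trans (cong (𝟙 (A ⊆? proj₁ B) *_) (f≡sum B))
                                         (sym (sum-*ˡ E (𝟙 (A ⊆? proj₁ B)) _))) ⟩
            sumOver K (λ B → sumOver E λ (i , j) → 𝟙 (A ⊆? proj₁ B) * edge a b i j B)
              ≡⟨ sum-swap K E _ ⟩
            sumOver E (λ (i , j) → sumOver K λ B → 𝟙 (A ⊆? proj₁ B) * edge a b i j B)
              ≡⟨ sum-cong-∈ E (λ {(i , j)} ij∈E → sum-edge (loopless E tournament ij∈E)) ⟩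
            sumOver E (λ (i , j) → φ i - φ j)
              ≡⟨ eulerian φ ⟩
            0ℤ ∎
            where
            open ≡-Reasoning
            -- The factor 2 appears because both positive blocks of an arc from i contain aᵢbᵢ.
            φ : Fin l → ℤ
            φ i = + 2 * (member A (a i) * member A (b i))

            distrib : ∀ c o o′ → c * (o - o′) ≡ o * c - o′ * c
            distrib = solve-∀

            -- The variables are the memberships of aᵢ, bᵢ, aⱼ, bⱼ in `A`. Each of the four mixed
            -- products occurs once with either sign, so only αβ and α′β′ survive, twice each.
            cancel : ∀ α β α′ β′ →
              (α * β + α * α′ + β * α′ + (α * β + α * β′ + β * β′)) -
              (α′ * β′ + α′ * α + β′ * α + (α′ * β′ + α′ * β + β′ * β)) ≡
              + 2 * (α * β) - + 2 * (α′ * β′)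
            cancel = solve-∀

            covered : ∀ {i j} → i ≢ j → 𝟙 (A ⊆? flag i false j) + 𝟙 (A ⊆? flag i true j) ≡ _
            covered {i} {j} i≢j = cong₂ _+_
              (𝟙-⊆-triple ∣A∣≡2 (disjoint i i) (i≢j ∘ a-injective) (disjoint j i ∘ sym))
              (𝟙-⊆-triple ∣A∣≡2 (disjoint i i) (disjoint i j) (i≢j ∘ b-injective))

            sum-edge : ∀ {i j} → i ≢ j →
              sumOver K (λ B → 𝟙 (A ⊆? proj₁ B) * edge a b i j B) ≡ φ i - φ j
            sum-edge {i} {j} i≢j = begin
              sumOver K (λ B → 𝟙 (A ⊆? proj₁ B) * edge a b i j B)
                ≡⟨ (sum-cong K λ B → distrib (𝟙 (A ⊆? proj₁ B)) (out i j B) (out j i B)) ⟩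
              sumOver K (λ B → out i j B * 𝟙 (A ⊆? proj₁ B) - out j i B * 𝟙 (A ⊆? proj₁ B))
                ≡⟨ sum-- K _ _ ⟩
              sumOver K (λ B → out i j B * 𝟙 (A ⊆? proj₁ B)) -
              sumOver K (λ B → out j i B * 𝟙 (A ⊆? proj₁ B))
                ≡⟨ cong₂ _-_ (trans (sum-out i≢j (λ S → 𝟙 (A ⊆? S))) (covered i≢j))
                             (trans (sum-out (i≢j ∘ sym) (λ S → 𝟙 (A ⊆? S))) (covered (i≢j ∘ sym))) ⟩
              _ ≡⟨ cancel (member A (a i)) (member A (b i)) (member A (a j)) (member A (b j)) ⟩
              φ i - φ j ∎

          tournament⇒trade : 3 ℕ.≤ v ∸ 2 → IsTrade 2 3 v f × HasVolume f (2 ℕ.* (l C 2))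
          tournament⇒trade 3≤v∸2 = record
            { t≤k      = s≤s (s≤s z≤n)
            ; k≤v∸t    = 3≤v∸2
            ; balanced = eulerian⇒balanced
            } , tournament⇒volume

-- Arcs of triangles and quadrangles, and the graphs that they cover.

module Cycles where
  open import Data.Integer.Base using (_+_; _-_; _*_)
  open Sums
  open Subsets
  open Tournaments

  x∈⋃⁺ : ∀ {v} {x : Fin v} {p ps} → p List.∈ ps → x ∈ p → x ∈ ⋃ ps
  x∈⋃⁺ (here refl)  x∈p = p⊆p∪q _ x∈p
  x∈⋃⁺ (there p∈ps) x∈p = q⊆p∪q _ _ (x∈⋃⁺ p∈ps x∈p)

  x∈⋃⁻ : ∀ {v} {x : Fin v} ps → x ∈ ⋃ ps → ∃ λ p → p List.∈ ps × x ∈ p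
  x∈⋃⁻ []       x∈ = contradiction x∈ ∉⊥
  x∈⋃⁻ (p ∷ ps) x∈ with x∈p∪q⁻ p (⋃ ps) x∈
  ... | inj₁ x∈p  = p , here refl , x∈p
  ... | inj₂ x∈ps with x∈⋃⁻ ps x∈ps
  ...   | q , q∈ps , x∈q = q , there q∈ps , x∈q

  -- Disjointness leaves at most one member containing the point, so adding up memberships never
  -- overcounts.
  sum-disjoint : ∀ {v} (x : Fin v) {ps} → AllPairs (λ p q → Empty (p ∩ q)) ps →
    sumOver ps (λ p → member p x) ≡ member (⋃ ps) x
  sum-disjoint x [] = sym (𝟙-no (x ∈? _) ∉⊥)
  sum-disjoint x {p ∷ ps} (p-disjoint ∷ rest) with x ∈? p
  ... | no  x∉p = trans (ℤ.+-identityˡ _) (trans (sum-disjoint x rest)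
    (𝟙-cong (x ∈? ⋃ ps) (x ∈? p ∪ ⋃ ps) (q⊆p∪q p _)
      ([ (λ x∈p → contradiction x∈p x∉p) , id ]′ ∘ x∈p∪q⁻ p _)))
  ... | yes x∈p = trans
    (cong (λ s → 1ℤ + s) (trans (sum-disjoint x rest) (𝟙-no (x ∈? ⋃ ps) x∉ps)))
    (sym (𝟙-yes (x ∈? p ∪ ⋃ ps) (p⊆p∪q _ x∈p)))
    where
    x∉ps : ¬ x ∈ ⋃ ps
    x∉ps x∈ps with x∈⋃⁻ ps x∈ps
    ... | q , q∈ps , x∈q = All.lookup p-disjoint q∈ps (x , x∈p∩q⁺ (x∈p , x∈q))

  below : ∀ {l} → ℕ → Fin l → ℤ
  below m p = 𝟙 (toℕ p ℕ.<? m)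

  -- Serves to split the last three indices off one by one in the construction of `h₂`.
  below-suc : ∀ {l m} {x : Fin l} → toℕ x ≡ m → ∀ p → below (suc m) p ≡ below m p + 𝟙 (p ≟ x)
  below-suc {x = x} refl p with p ≟ x
  ... | yes refl = trans (𝟙-yes (toℕ p ℕ.<? suc (toℕ p)) ℕ.≤-refl)
    (cong (_+ 1ℤ) (sym (𝟙-no (toℕ p ℕ.<? toℕ p) (ℕ.<-irrefl refl))))
  ... | no  p≢x  = trans
    (𝟙-cong (toℕ p ℕ.<? suc (toℕ x)) (toℕ p ℕ.<? toℕ x)
      (λ p≤x → ℕ.≤∧≢⇒< (ℕ.s≤s⁻¹ p≤x) (p≢x ∘ toℕ-injective)) ℕ.m<n⇒m<1+n)
    (sym (ℤ.+-identityʳ _))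

  toℕ-fromTop : ∀ m k → toℕ (fromTop m k) ≡ m ∸ k
  toℕ-fromTop m k = toℕ-fromℕ< (s≤s (ℕ.m∸n≤m m k))

  module _ {l : ℕ} where

    triangle : Triple l → Arcs l
    triangle (i , j , k) = (i , j) ∷ (j , k) ∷ (k , i) ∷ []

    quadrangle : Fin l → Fin l → Pair l → Arcs l
    quadrangle u w (i , j) = (u , i) ∷ (i , w) ∷ (w , j) ∷ (j , u) ∷ []

    -- The tournament equation without its diagonal term. It is additive under concatenation, so
    -- each family of cycles can be evaluated on its own.
    joins : Arcs l → Fin l → Fin l → ℤ
    joins E p q = multiplicity E p q + multiplicity E q p

    joins-++ : ∀ E F p q → joins (E ++ F) p q ≡ joins E p q + joins F p q
    joins-++ E F p q = trans (cong₂ _+_ (sum-++ E F _) (sum-++ E F _))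
      (regroup (multiplicity E p q) (multiplicity F p q) (multiplicity E q p) (multiplicity F q p))
      where
      regroup : ∀ a b c d → a + b + (c + d) ≡ a + c + (b + d)
      regroup = solve-∀

    joins-concatMap : ∀ {A : Set} (g : A → Arcs l) xs p q →
      joins (concatMap g xs) p q ≡ sumOver xs (λ x → joins (g x) p q)
    joins-concatMap g xs p q =
      trans (cong₂ _+_ (sum-concatMap g xs _) (sum-concatMap g xs _)) (sym (sum-+ xs _ _))

    Eulerian-++ : ∀ {E F : Arcs l} → Eulerian E → Eulerian F → Eulerian (E ++ F)
    Eulerian-++ {E} {F} eulerianE eulerianF φ =
      trans (sum-++ E F _) (cong₂ _+_ (eulerianE φ) (eulerianF φ))

    Eulerian-concatMap : ∀ {A : Set} (g : A → Arcs l) → (∀ x → Eulerian (g x)) →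
      ∀ xs → Eulerian (concatMap g xs)
    Eulerian-concatMap g eulerian xs φ =
      trans (sum-concatMap g xs _) (trans (sum-cong xs λ x → eulerian x φ) (sum-0 xs))

    Eulerian-triangle : ∀ t → Eulerian (triangle t)
    Eulerian-triangle (i , j , k) φ = telescope (φ i) (φ j) (φ k)
      where
      telescope : ∀ x y z → x - y + (y - z + (z - x + 0ℤ)) ≡ 0ℤ
      telescope = solve-∀

    Eulerian-quadrangle : ∀ u w P → Eulerian (quadrangle u w P)
    Eulerian-quadrangle u w (i , j) φ = telescope (φ u) (φ i) (φ w) (φ j)
      where
      telescope : ∀ x y z t → x - y + (y - z + (z - t + (t - x + 0ℤ))) ≡ 0ℤ
      telescope = solve-∀

    -- Both sides say p = q = i. The right side exposes a factor independent of i, under which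
    -- diagonal terms can be collected.
    𝟙-≟-diagonal : ∀ (p q i : Fin l) → 𝟙 (p ≟ i) * 𝟙 (q ≟ i) ≡ 𝟙 (p ≟ q) * 𝟙 (p ≟ i)
    𝟙-≟-diagonal p q i with p ≟ i
    ... | no  _    = sym (ℤ.*-zeroʳ (𝟙 (p ≟ q)))
    ... | yes refl = trans (ℤ.*-identityˡ _)
      (trans (𝟙-cong (q ≟ p) (p ≟ q) sym sym) (sym (ℤ.*-identityʳ _)))

    inPair : Pair l → Fin l → ℤ
    inPair (i , j) p = 𝟙 (p ≟ i) + 𝟙 (p ≟ j)

    inTriple : Triple l → Fin l → ℤ
    inTriple (i , j , k) p = 𝟙 (p ≟ i) + 𝟙 (p ≟ j) + 𝟙 (p ≟ k)

    -- A triangle joins any two of its three places once. Of the nine products in the expansion, the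
    -- three that repeat a place are subtracted.
    joins-triangle : ∀ t p q →
      joins (triangle t) p q ≡ inTriple t p * inTriple t q - 𝟙 (p ≟ q) * inTriple t p
    joins-triangle t@(i , j , k) p q = begin
      joins (triangle t) p q
        ≡⟨ expand (𝟙 (p ≟ i)) (𝟙 (p ≟ j)) (𝟙 (p ≟ k)) (𝟙 (q ≟ i)) (𝟙 (q ≟ j)) (𝟙 (q ≟ k)) ⟩
      inTriple t p * inTriple t q -
        (𝟙 (p ≟ i) * 𝟙 (q ≟ i) + 𝟙 (p ≟ j) * 𝟙 (q ≟ j) + 𝟙 (p ≟ k) * 𝟙 (q ≟ k))
        ≡⟨ cong (λ s → inTriple t p * inTriple t q - s)
             (cong₂ _+_ (cong₂ _+_ (𝟙-≟-diagonal p q i) (𝟙-≟-diagonal p q j)) (𝟙-≟-diagonal p q k)) ⟩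
      inTriple t p * inTriple t q -
        (𝟙 (p ≟ q) * 𝟙 (p ≟ i) + 𝟙 (p ≟ q) * 𝟙 (p ≟ j) + 𝟙 (p ≟ q) * 𝟙 (p ≟ k))
        ≡⟨ cong (λ s → inTriple t p * inTriple t q - s)
             (factor (𝟙 (p ≟ q)) (𝟙 (p ≟ i)) (𝟙 (p ≟ j)) (𝟙 (p ≟ k))) ⟩
      inTriple t p * inTriple t q - 𝟙 (p ≟ q) * inTriple t p ∎
      where
      open ≡-Reasoning
      expand : ∀ x y z x′ y′ z′ →
        x * y′ + (y * z′ + (z * x′ + 0ℤ)) + (x′ * y + (y′ * z + (z′ * x + 0ℤ))) ≡
        (x + y + z) * (x′ + y′ + z′) - (x * x′ + y * y′ + z * z′)
      expand = solve-∀
      factor : ∀ d x y z → d * x + d * y + d * z ≡ d * (x + y + z)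
      factor = solve-∀

    -- The 4-cycle u, i, w, j is the complete bipartite graph between {u, w} and {i, j}.
    joins-quadrangle : ∀ u w P p q → joins (quadrangle u w P) p q ≡
      inPair (u , w) p * inPair P q + inPair P p * inPair (u , w) q
    joins-quadrangle u w (i , j) p q = expand
      (𝟙 (p ≟ u)) (𝟙 (p ≟ w)) (𝟙 (p ≟ i)) (𝟙 (p ≟ j)) (𝟙 (q ≟ u)) (𝟙 (q ≟ w)) (𝟙 (q ≟ i)) (𝟙 (q ≟ j))
      where
      expand : ∀ u w i j u′ w′ i′ j′ →
        u * i′ + (i * w′ + (w * j′ + (j * u′ + 0ℤ))) + (u′ * i + (i′ * w + (w′ * j + (j′ * u + 0ℤ)))) ≡
        (u + w) * (i′ + j′) + (i + j) * (u′ + w′)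
      expand = solve-∀

  -- Counting through pair partitions and Steiner triple systems.

  module _ {v l : ℕ} {a : Fin l → Fin v} (a-injective : Injective _≡_ _≡_ a) where

    ∈-firstPoints⁺ : ∀ {m p} → toℕ p < m → a p ∈ firstPoints a m
    ∈-firstPoints⁺ {m} {p} p<m = x∈⋃⁺
      (∈-map⁺ (⁅_⁆ ∘ a) (∈-filter⁺ (λ i → toℕ i ℕ.<? m) (∈-allFin p) p<m)) (x∈⁅x⁆ (a p))

    ∈-firstPoints⁻ : ∀ {m p} → a p ∈ firstPoints a m → toℕ p < m
    ∈-firstPoints⁻ {m} {p} ap∈ with x∈⋃⁻ (map (⁅_⁆ ∘ a) (filter (λ i → toℕ i ℕ.<? m) (allFin l))) ap∈
    ... | _ , ⁅ai⁆∈ , ap∈⁅ai⁆ with ∈-map⁻ (⁅_⁆ ∘ a) ⁅ai⁆∈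
    ...   | i , i∈ , refl with a-injective (x∈⁅y⁆⇒x≡y (a i) ap∈⁅ai⁆)
    ...     | refl = proj₂ (∈-filter⁻ (λ i → toℕ i ℕ.<? m) {xs = allFin l} i∈)

    -- Size 2 excludes i = j, where `inPair` would reach 2 while membership stays 1.
    member-pairSet : ∀ {P} → ∣ pairSet a P ∣ ≡ 2 → ∀ p → inPair P p ≡ member (pairSet a P) (a p)
    member-pairSet {i , j} ∣P∣≡2 p with p ≟ i | p ≟ j
    ... | yes refl | yes refl = contradiction refl (∣pair∣≡2⇒≢ {x = a i} ∣P∣≡2)
    ... | yes refl | no  _    = sym (𝟙-yes (a p ∈? _) (∈-pair₁ _ _))
    ... | no  _    | yes refl = sym (𝟙-yes (a p ∈? _) (∈-pair₂ _ _))
    ... | no  p≢i  | no  p≢j  = sym (𝟙-no (a p ∈? _)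
      ([ p≢i ∘ a-injective , p≢j ∘ a-injective ]′ ∘ ∈-pair⁻ _ _))

    member-tripleSet : ∀ {t} → ∣ tripleSet a t ∣ ≡ 3 →
      ∀ p → inTriple t p ≡ member (tripleSet a t) (a p)
    member-tripleSet {i , j , k} ∣t∣≡3 p with ∣triple∣≡3⇒distinct {x = a i} ∣t∣≡3
    ... | ai≢aj , ai≢ak , aj≢ak with p ≟ i | p ≟ j | p ≟ k
    ... | yes refl | yes refl | _        = contradiction refl ai≢aj
    ... | yes refl | no  _    | yes refl = contradiction refl ai≢ak
    ... | no  _    | yes refl | yes refl = contradiction refl aj≢ak
    ... | yes refl | no  _    | no  _    = sym (𝟙-yes (a p ∈? _) (∈-triple₁ _ _ _))
    ... | no  _    | yes refl | no  _    = sym (𝟙-yes (a p ∈? _) (∈-triple₂ _ _ _))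
    ... | no  _    | no  _    | yes refl = sym (𝟙-yes (a p ∈? _) (∈-triple₃ _ _ _))
    ... | no  p≢i  | no  p≢j  | no  p≢k  = sym (𝟙-no (a p ∈? _)
      ([ p≢i ∘ a-injective , [ p≢j ∘ a-injective , p≢k ∘ a-injective ]′ ]′ ∘ ∈-triple⁻ _ _ _))

    -- Each of the first m indices lies in exactly one pair of the partition, and every other index
    -- in none.
    sum-inPair : ∀ {m S} → IsPairPartition (firstPoints a m) (map (pairSet a) S) →
      ∀ p → sumOver S (λ P → inPair P p) ≡ below m p
    sum-inPair {m} {S} partition p = begin
      sumOver S (λ P → inPair P p)
        ≡⟨ sum-cong-∈ S (λ P∈S → member-pairSet (All.lookup pairs (∈-map⁺ (pairSet a) P∈S)) p) ⟩
      sumOver S (λ P → member (pairSet a P) (a p))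
        ≡⟨ sym (sum-map (pairSet a) S _) ⟩
      sumOver (map (pairSet a) S) (λ P → member P (a p))
        ≡⟨ sum-disjoint (a p) disjoint ⟩
      member (⋃ (map (pairSet a) S)) (a p)
        ≡⟨ cong (λ Y → member Y (a p)) covers ⟩
      member (firstPoints a m) (a p)
        ≡⟨ 𝟙-cong (a p ∈? firstPoints a m) (toℕ p ℕ.<? m) ∈-firstPoints⁻ ∈-firstPoints⁺ ⟩
      below m p ∎
      where
      open ≡-Reasoning
      open IsPairPartition partition

    module _ {m sts} (isSTS : IsSTS m (firstPoints a m) (map (tripleSet a) sts)) where
      open IsSTS isSTS

      private
        block-facts : ∀ {t} → t List.∈ sts → ∣ tripleSet a t ∣ ≡ 3 × tripleSet a t ⊆ firstPoints a m
        block-facts t∈sts = All.lookup blocks (∈-map⁺ (tripleSet a) t∈sts)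

      -- The sum counts the blocks through two distinct points: one by the Steiner property when
      -- both are among the first m, and none otherwise, since blocks stay inside the point set.
      sum-common-blocks : ∀ {p q} → p ≢ q →
        sumOver sts (λ t → member (tripleSet a t) (a p) * member (tripleSet a t) (a q)) ≡
        below m p * below m q
      sum-common-blocks {p} {q} p≢q with toℕ p ℕ.<? m | toℕ q ℕ.<? m
      ... | no  p≮m | _       = trans (sum-cong-∈ sts λ {t} t∈sts → cong (_* _)
        (𝟙-no (a p ∈? _) (p≮m ∘ ∈-firstPoints⁻ ∘ proj₂ (block-facts t∈sts)))) (trans (sum-0 sts)
        (sym (cong (_* below m q) (𝟙-no (toℕ p ℕ.<? m) p≮m))))
      ... | yes _   | no  q≮m = trans (sum-cong-∈ sts λ {t} t∈sts → trans
        (cong (member (tripleSet a t) (a p) *_) (𝟙-no (a q ∈? _) (q≮m ∘ ∈-firstPoints⁻ ∘ proj₂ (block-facts t∈sts))))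
        (ℤ.*-zeroʳ (member (tripleSet a t) (a p)))) (trans (sum-0 sts)
        (sym (trans (cong (below m p *_) (𝟙-no (toℕ q ℕ.<? m) q≮m)) (ℤ.*-zeroʳ (below m p)))))
      ... | yes p<m | yes q<m with steiner (⁅ a p ⁆ ∪ ⁅ a q ⁆ , ∣pair∣ (p≢q ∘ a-injective))
                                           (pair⊆ (∈-firstPoints⁺ p<m) (∈-firstPoints⁺ q<m))
      ...   | B , (B∈𝓑 , pq⊆B) , unique-B = begin
        sumOver sts (λ t → member (tripleSet a t) (a p) * member (tripleSet a t) (a q))
          ≡⟨ (sum-cong sts λ t → member*member (tripleSet a t)) ⟩
        sumOver sts (λ t → 𝟙 (⁅ a p ⁆ ∪ ⁅ a q ⁆ ⊆? tripleSet a t))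
          ≡⟨ sym (sum-map (tripleSet a) sts _) ⟩
        sumOver (map (tripleSet a) sts) (λ B → 𝟙 (⁅ a p ⁆ ∪ ⁅ a q ⁆ ⊆? B))
          ≡⟨ sum-unique (λ B → ⁅ a p ⁆ ∪ ⁅ a q ⁆ ⊆? B) _≟ˢ_ unique B∈𝓑 pq⊆B
               (λ C∈𝓑 pq⊆C → sym (unique-B (C∈𝓑 , pq⊆C))) ⟩
        1ℤ * 1ℤ
          ≡⟨ sym (cong₂ _*_ (𝟙-yes (toℕ p ℕ.<? m) p<m) (𝟙-yes (toℕ q ℕ.<? m) q<m)) ⟩
        below m p * below m q ∎
        where
        open ≡-Reasoning
        member*member : ∀ p′ → member p′ (a p) * member p′ (a q) ≡ 𝟙 (⁅ a p ⁆ ∪ ⁅ a q ⁆ ⊆? p′)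
        member*member B with a p ∈? B | a q ∈? B
        ... | yes p∈B | yes q∈B = sym (𝟙-yes (⁅ a p ⁆ ∪ ⁅ a q ⁆ ⊆? B) (pair⊆ p∈B q∈B))
        ... | yes _   | no  q∉B = sym (𝟙-no (⁅ a p ⁆ ∪ ⁅ a q ⁆ ⊆? B) λ pq⊆B → q∉B (pq⊆B (∈-pair₂ _ _)))
        ... | no  p∉B | _       = sym (𝟙-no (⁅ a p ⁆ ∪ ⁅ a q ⁆ ⊆? B) λ pq⊆B → p∉B (pq⊆B (∈-pair₁ _ _)))

      -- On the first m points this is the complete graph: the subtracted term
      -- cancels the product when p = q.
      joins-sts : ∀ p q → joins (concatMap triangle sts) p q ≡
        below m p * below m q - 𝟙 (p ≟ q) * below m p
      joins-sts p q = trans (trans (joins-concatMap triangle sts p q) (sum-cong-∈ sts λ {t} t∈sts →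
        trans (joins-triangle t p q) (cong₂ (λ x y → x * y - 𝟙 (p ≟ q) * x)
          (member-tripleSet (proj₁ (block-facts t∈sts)) p)
          (member-tripleSet (proj₁ (block-facts t∈sts)) q)))) (evaluate p q)
        where
        𝟙-idempotent : ∀ {P : Set} (P? : Dec P) → 𝟙 P? * 𝟙 P? - 1ℤ * 𝟙 P? ≡ 0ℤ
        𝟙-idempotent (yes _) = refl
        𝟙-idempotent (no _)  = refl
        minus-0* : ∀ x y → x - 0ℤ * y ≡ x
        minus-0* = solve-∀
        evaluate : ∀ p q → sumOver sts (λ t →
          member (tripleSet a t) (a p) * member (tripleSet a t) (a q) -
          𝟙 (p ≟ q) * member (tripleSet a t) (a p)) ≡ below m p * below m q - 𝟙 (p ≟ q) * below m p
        evaluate p q with p ≟ q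
        ... | yes refl = trans
          (trans (sum-cong sts λ t → 𝟙-idempotent (a p ∈? tripleSet a t)) (sum-0 sts))
          (sym (𝟙-idempotent (toℕ p ℕ.<? m)))
        ... | no  p≢q  = trans (sum-cong sts λ t → minus-0* _ (member (tripleSet a t) (a p)))
                               (trans (sum-common-blocks p≢q) (sym (minus-0* _ (below m p))))

  -- The two constructions as tournaments.

  module _ {v l : ℕ} {a b : Fin l → Fin v} (labelling : IsLabelling a b) (3≤v∸2 : 3 ℕ.≤ v ∸ 2) where
    open IsLabelling labelling

    h₁-trade : ∀ sts → IsSTS l (firstPoints a l) (map (tripleSet a) sts) →
      IsTrade 2 3 v (h₁ a b sts) × HasVolume (h₁ a b sts) (2 ℕ.* (l C 2))
    h₁-trade sts isSTS = tournament⇒trade labelling {E = concatMap triangle sts} tournament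
      -- `T` on the closed list β₀β₁β₂β₀ unfolds to the sum of `edge` over `triangle`, so only the
      -- concatenation has to be undone.
      (λ B → sym (sum-concatMap triangle sts λ (i , j) → edge a b i j B))
      (Eulerian-concatMap triangle Eulerian-triangle sts) 3≤v∸2
      where
      cancel : ∀ d → 1ℤ * 1ℤ - d * 1ℤ + d ≡ 1ℤ
      cancel = solve-∀
      tournament : Tournament (concatMap triangle sts)
      -- With m = l every index lies below the threshold, so both `below` factors become 1.
      tournament p q = trans (cong (_+ 𝟙 (p ≟ q)) (trans (joins-sts a-injective isSTS p q)
        (cong₂ (λ x y → x * y - 𝟙 (p ≟ q) * x) (𝟙-yes (toℕ p ℕ.<? l) (toℕ<n p))
                                               (𝟙-yes (toℕ q ℕ.<? l) (toℕ<n q)))))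
        (cancel (𝟙 (p ≟ q)))

  module _ {v n : ℕ} {a b : Fin (suc (2 ℕ.* n)) → Fin v} (labelling : IsLabelling a b)
           (1≤n : 1 ℕ.≤ n) (3≤v∸2 : 3 ℕ.≤ v ∸ 2) where
    open IsLabelling labelling

    private
      -- The indices 2n-2, 2n-1 and 2n of `h₂`. Here x is the one index of the Steiner system that
      -- the pairs of S leave out.
      x u w : Fin (suc (2 ℕ.* n))
      x = fromTop (2 ℕ.* n) 2
      u = fromTop (2 ℕ.* n) 1
      w = fromTop (2 ℕ.* n) 0

      2≤2n : 2 ℕ.≤ 2 ℕ.* n
      2≤2n = ℕ.*-monoʳ-≤ 2 1≤n

      below-2n-1 : ∀ p → below (2 ℕ.* n ∸ 1) p ≡ below (2 ℕ.* n ∸ 2) p + 𝟙 (p ≟ x)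
      -- Subtraction is truncated: reading 2n ∸ 1 as the successor of 2n ∸ 2 relies on n ≥ 1.
      below-2n-1 p = subst (λ m → below m p ≡ below (2 ℕ.* n ∸ 2) p + 𝟙 (p ≟ x))
        (sym (ℕ.+-∸-assoc 1 2≤2n)) (below-suc (toℕ-fromTop (2 ℕ.* n) 2) p)

      below-2n : ∀ p → below (2 ℕ.* n) p ≡ below (2 ℕ.* n ∸ 1) p + 𝟙 (p ≟ u)
      below-2n p = subst (λ m → below m p ≡ below (2 ℕ.* n ∸ 1) p + 𝟙 (p ≟ u))
        (sym (ℕ.+-∸-assoc 1 (ℕ.<⇒≤ 2≤2n))) (below-suc (toℕ-fromTop (2 ℕ.* n) 1) p)

      below-2n+1 : ∀ p → below (suc (2 ℕ.* n)) p ≡ below (2 ℕ.* n) p + 𝟙 (p ≟ w)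
      below-2n+1 = below-suc (toℕ-fromTop (2 ℕ.* n) 0)

      -- Every index is below 2n-2 or is exactly one of x, u, w.
      total≡1 : ∀ p → below (2 ℕ.* n ∸ 2) p + 𝟙 (p ≟ x) + 𝟙 (p ≟ u) + 𝟙 (p ≟ w) ≡ 1ℤ
      total≡1 p = begin
        below (2 ℕ.* n ∸ 2) p + 𝟙 (p ≟ x) + 𝟙 (p ≟ u) + 𝟙 (p ≟ w)
          ≡⟨ cong (λ s → s + 𝟙 (p ≟ u) + 𝟙 (p ≟ w)) (sym (below-2n-1 p)) ⟩
        below (2 ℕ.* n ∸ 1) p + 𝟙 (p ≟ u) + 𝟙 (p ≟ w)
          ≡⟨ cong (_+ 𝟙 (p ≟ w)) (sym (below-2n p)) ⟩
        below (2 ℕ.* n) p + 𝟙 (p ≟ w)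
          ≡⟨ sym (below-2n+1 p) ⟩
        below (suc (2 ℕ.* n)) p
          ≡⟨ 𝟙-yes (toℕ p ℕ.<? suc (2 ℕ.* n)) (toℕ<n p) ⟩
        1ℤ ∎
        where open ≡-Reasoning

    h₂-trade : ∀ sts → IsSTS (2 ℕ.* n ∸ 1) (firstPoints a (2 ℕ.* n ∸ 1)) (map (tripleSet a) sts) →
      ∀ S → IsPairPartition (firstPoints a (2 ℕ.* n ∸ 2)) (map (pairSet a) S) →
      IsTrade 2 3 v (h₂ n a b sts S) × HasVolume (h₂ n a b sts S) (2 ℕ.* (suc (2 ℕ.* n) C 2))
    h₂-trade sts isSTS S partition = tournament⇒trade labelling {E = E} tournament f≡sum eulerian 3≤v∸2
      where
      E₁ E₂ E₃ E : Arcs (suc (2 ℕ.* n))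
      E₁ = concatMap triangle sts
      E₂ = triangle (x , u , w)
      E₃ = concatMap (quadrangle u w) S
      E  = (E₁ ++ E₂) ++ E₃

      f≡sum : ∀ B → h₂ n a b sts S B ≡ sumOver E (λ (i , j) → edge a b i j B)
      f≡sum B = sym (trans (sum-++ (E₁ ++ E₂) E₃ _) (cong₂ _+_
        (trans (sum-++ E₁ E₂ _) (cong (_+ _) (sum-concatMap triangle sts _)))
        (sum-concatMap (quadrangle u w) S _)))

      eulerian : Eulerian E
      eulerian = Eulerian-++ {E = E₁ ++ E₂} {E₃}
        (Eulerian-++ {E = E₁} {E₂} (Eulerian-concatMap triangle Eulerian-triangle sts)
                                   (Eulerian-triangle (x , u , w)))
        (Eulerian-concatMap (quadrangle u w) (Eulerian-quadrangle u w) S)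

      -- As the pairs of S exhaust the indices below 2n-2, the bipartite graphs of the quadrangles
      -- assemble into the complete bipartite graph between {u, w} and those indices.
      joins-E₃ : ∀ p q → joins E₃ p q ≡
        inPair (u , w) p * below (2 ℕ.* n ∸ 2) q + below (2 ℕ.* n ∸ 2) p * inPair (u , w) q
      joins-E₃ p q = begin
        joins E₃ p q
          ≡⟨ joins-concatMap (quadrangle u w) S p q ⟩
        sumOver S (λ P → joins (quadrangle u w P) p q)
          ≡⟨ (sum-cong S λ P → joins-quadrangle u w P p q) ⟩
        sumOver S (λ P → inPair (u , w) p * inPair P q + inPair P p * inPair (u , w) q)
          ≡⟨ sum-+ S _ _ ⟩
        sumOver S (λ P → inPair (u , w) p * inPair P q) +
        sumOver S (λ P → inPair P p * inPair (u , w) q)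
          ≡⟨ cong₂ _+_
               (trans (sum-*ˡ S (inPair (u , w) p) _)
                      (cong (inPair (u , w) p *_) (sum-inPair a-injective {2 ℕ.* n ∸ 2} partition q)))
               (trans (sum-*ʳ S (inPair (u , w) q) _)
                      (cong (_* inPair (u , w) q) (sum-inPair a-injective {2 ℕ.* n ∸ 2} partition p))) ⟩
        _ ∎
        where open ≡-Reasoning

      tournament : Tournament E
      tournament p q = begin
        joins E p q + d
          ≡⟨ cong (_+ d) (trans (joins-++ (E₁ ++ E₂) E₃ p q)
                                (cong (_+ joins E₃ p q) (joins-++ E₁ E₂ p q))) ⟩
        joins E₁ p q + joins E₂ p q + joins E₃ p q + d
          ≡⟨ cong (_+ d) (cong₂ _+_ (cong₂ _+_
               (trans (joins-sts a-injective isSTS p q)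
                      (cong₂ (λ s t → s * t - d * s) (below-2n-1 p) (below-2n-1 q)))
               (joins-triangle (x , u , w) p q)) (joins-E₃ p q)) ⟩
        -- Writing k for the indices below 2n-2, the three families are complete on k + x, complete
        -- on x + u + w, and bipartite between k and u + w. Together they are complete on
        -- everything; the only overlap is x with itself, and its excess x x′ - d x vanishes by
        -- `𝟙-≟-diagonal`.
        _ ≡⟨ expand d (below (2 ℕ.* n ∸ 2) p) (𝟙 (p ≟ x)) (𝟙 (p ≟ u)) (𝟙 (p ≟ w))
                      (below (2 ℕ.* n ∸ 2) q) (𝟙 (q ≟ x)) (𝟙 (q ≟ u)) (𝟙 (q ≟ w)) ⟩
        _ ≡⟨ cong₂ (λ s t → s * t - d * s + d + (𝟙 (p ≟ x) * 𝟙 (q ≟ x) - d * 𝟙 (p ≟ x)))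
                   (total≡1 p) (total≡1 q) ⟩
        1ℤ * 1ℤ - d * 1ℤ + d + (𝟙 (p ≟ x) * 𝟙 (q ≟ x) - d * 𝟙 (p ≟ x))
          ≡⟨ cong (λ s → 1ℤ * 1ℤ - d * 1ℤ + d + (s - d * 𝟙 (p ≟ x))) (𝟙-≟-diagonal p q x) ⟩
        1ℤ * 1ℤ - d * 1ℤ + d + (d * 𝟙 (p ≟ x) - d * 𝟙 (p ≟ x))
          ≡⟨ cancel d (d * 𝟙 (p ≟ x)) ⟩
        1ℤ ∎
        where
        open ≡-Reasoning
        d = 𝟙 (p ≟ q)
        cancel : ∀ d y → 1ℤ * 1ℤ - d * 1ℤ + d + (y - y) ≡ 1ℤ
        cancel = solve-∀
        expand : ∀ d k x u w k′ x′ u′ w′ →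
          (k + x) * (k′ + x′) - d * (k + x) +
          ((x + u + w) * (x′ + u′ + w′) - d * (x + u + w)) +
          ((u + w) * k′ + k * (u′ + w′)) + d ≡
          (k + x + u + w) * (k′ + x′ + u′ + w′) - d * (k + x + u + w) + d + (x * x′ - d * x)
        expand = solve-∀

-- The theorem on 4n + 2 points.

open Cycles using (h₁-trade; h₂-trade)
open import Data.Nat using (ℕ; suc; _+_; _*_; _∸_; _%_; _≤_)
open import Data.Fin using (Fin)
open import Data.List using (List; map)
open import Data.Product using (_×_)
open import Data.Sum using (_⊎_)

theorem2p2 : (n : ℕ) → 1 ≤ n →
    (a b : Fin (suc (2 * n)) → Fin (4 * n + 2)) → IsLabelling a b →
    ( (suc (2 * n) % 6 ≡ 1 ⊎ suc (2 * n) % 6 ≡ 3) →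
    (sts : List (Triple (suc (2 * n)))) →
    IsSTS (suc (2 * n)) (firstPoints a (suc (2 * n))) (map (tripleSet a) sts) →
    IsTrade 2 3 (4 * n + 2) (h₁ a b sts)
    × HasVolume (h₁ a b sts) (2 * (suc (2 * n) C 2)) )
    ×
    ( suc (2 * n) % 6 ≡ 5 →
    (sts : List (Triple (suc (2 * n)))) →
    IsSTS (2 * n ∸ 1) (firstPoints a (2 * n ∸ 1)) (map (tripleSet a) sts) →
    (S : List (Pair (suc (2 * n)))) →
    IsPairPartition (firstPoints a (2 * n ∸ 2)) (map (pairSet a) S) →
    IsTrade 2 3 (4 * n + 2) (h₂ n a b sts S)
    × HasVolume (h₂ n a b sts S) (2 * (suc (2 * n) C 2)) )
theorem2p2 n 1≤n a b labelling =
  (λ _ → h₁-trade labelling 3≤v∸2) , (λ _ → h₂-trade labelling 1≤n 3≤v∸2)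
  where
  3≤v∸2 : 3 ≤ 4 * n + 2 ∸ 2
  -- The right side is 4n, which is at least 4 because n ≥ 1.
  3≤v∸2 = ℕ.≤-trans (ℕ.n≤1+n 3)
    (ℕ.≤-trans (ℕ.*-monoʳ-≤ 4 1≤n) (ℕ.≤-reflexive (sym (ℕ.m+n∸n≡m (4 * n) 2))))
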